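{- For all integers $n \geq 1$ and all real $x$, $$-\frac{B_{n}(x)}{n} = \sum_{m=1}^n \frac{c_{m}(x)}{m} \genfrac{\{}{\}}{0pt}{}{n-1}{m-1}_x$$ and $$\frac{(-1)^{n}- B_{n}(x)}{n} = \sum_{m=1}^n \frac{\widehat{c}_{m}(-x)}{m}\genfrac{\{}{\}}{0pt}{}{n-1}{m-1}_x.$$
   Context: For real $z$ and integer $n\ge 0$, $\binom{z}{n} = \frac{z(z-1)\cdots(z-n+1)}{n!}$. The Cauchy polynomials of the first and second kind are $c_n(x) = n! \int_{0}^{1} \binom{t - x}{n}\, dt$ and $\widehat{c}_n(x) = n! \int_{0}^{1} \binom{x - t}{n}\, dt$, $n \ge 0$. $B_n(x)$ are the classical Bernoulli polynomials, $\frac{te^{xt}}{e^t-1}=\sum_{n\ge0}B_n(x)\frac{t^n}{n!}$. The generalized Stirling numbers of the second kind are $\genfrac{\{}{\}}{0pt}{}{n}{m}_x = \sum_{i=0}^{n-m} \binom{n}{i}\genfrac{\{}{\}}{0pt}{}{n-i}{m} x^i$ for $0 \leq m \leq n$ and $x\in\mathbb{R}$, where $\genfrac{\{}{\}}{0pt}{}{n}{m}$ are the ordinary Stirling numbers of the second kind and $x^0=1$. -}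

module Defs where

open import Algebra.Bundles.Raw using (RawRing)
open import Data.Fin.Base as Fin using (Fin; zero; suc; toℕ; inject₁)
open import Data.Integer.Base as ℤ using ()
open import Data.Nat.Base as ℕ using (ℕ; zero; suc; NonZero; _!; _∸_)
import Data.Nat.Properties as ℕ
open import Data.Nat.Combinatorics using (_C_)
open import Data.Product using (Σ-syntax; ∃-syntax; _×_; _,_)
open import Data.Rational.Base as ℚ using (ℚ; 0ℚ; 1ℚ)
import Data.Rational.Properties as ℚ
open import Data.Rational.Solver using (module +-*-Solver)
open import Data.Sum.Base using (inj₁; inj₂)
open import Function.Base using (_∘_)
open import Level using (0ℓ)
open import Relation.Binary.PropositionalEquality
  using (_≡_; refl; sym; trans; cong; cong₂; subst; subst₂)

IsCauchy : (ℕ → ℚ) → Set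
IsCauchy s = ∀ ε → 0ℚ ℚ.< ε →
  ∃[ N ] ∀ m n → N ℕ.≤ m → N ℕ.≤ n → ℚ.∣ s m ℚ.- s n ∣ ℚ.< ε

-- Equality of reals is _≃_ below, not _≡_.
record ℝ : Set where
  constructor mkℝ
  field
    seq    : ℕ → ℚ
    cauchy : IsCauchy seq

open ℝ public

module _ where
  open import Data.Rational.Base
  open ℚ.≤-Reasoning

  private
    open +-*-Solver

    +-minus : ∀ a b c d → a + b - (c + d) ≡ (a - c) + (b - d)
    +-minus = solve 4 (λ a b c d → a :+ b :- (c :+ d) := (a :- c) :+ (b :- d)) refl

    *-minus : ∀ a b c d → a * b - c * d ≡ a * (b - d) + d * (a - c)
    *-minus = solve 4 (λ a b c d → a :* b :- c :* d := a :* (b :- d) :+ d :* (a :- c)) refl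

    minus-swap : ∀ p q → p - q ≡ - (q - p)
    minus-swap = solve 2 (λ p q → p :- q := :- (q :- p)) refl

    neg-minus : ∀ p q → - (p - q) ≡ - p - - q
    neg-minus = solve 2 (λ p q → :- (p :- q) := :- p :- (:- q)) refl

    plus-minus : ∀ p q → p ≡ q + (p - q)
    plus-minus = solve 2 (λ p q → p := q :+ (p :- q)) refl

    cancel : ∀ p q → p + q - p ≡ q
    cancel = solve 2 (λ p q → p :+ q :- p := q) refl

    regroup : ∀ k e r → k * (e * r + e * r) ≡ e * ((k + k) * r)
    regroup = solve 3 (λ k e r → k :* (e :* r :+ e :* r) := e :* ((k :+ k) :* r)) refl

    split : ∀ K → 0ℚ < K → ∀ ε → 0ℚ < ε →
            ∃[ δ ] 0ℚ < δ × K * (δ + δ) ≡ ε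
    split K 0<K ε 0<ε = ε * r , ℚ.positive⁻¹ (ε * r) , eq
      where
      instance
        _ = positive 0<K
        _ = positive 0<ε
        _ = ℚ.pos+pos⇒pos K K
        _ = ℚ.pos⇒nonZero (K + K)
      r = 1/ (K + K)
      instance
        _ = ℚ.1/pos⇒pos (K + K)
        _ = ℚ.pos*pos⇒pos ε r
      eq : K * (ε * r + ε * r) ≡ ε
      eq = begin-equality
        K * (ε * r + ε * r) ≡⟨ regroup K ε r ⟩
        ε * ((K + K) * r)   ≡⟨ cong (ε *_) (ℚ.*-inverseʳ (K + K)) ⟩
        ε * 1ℚ              ≡⟨ ℚ.*-identityʳ ε ⟩
        ε                   ∎

    ∣p∣≤∣q∣+∣p-q∣ : ∀ p q → ∣ p ∣ ≤ ∣ q ∣ + ∣ p - q ∣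
    ∣p∣≤∣q∣+∣p-q∣ p q = begin
      ∣ p ∣             ≡⟨ cong ∣_∣ (plus-minus p q) ⟩
      ∣ q + (p - q) ∣   ≤⟨ ℚ.∣p+q∣≤∣p∣+∣q∣ q (p - q) ⟩
      ∣ q ∣ + ∣ p - q ∣ ∎

    ∣p-q∣≡∣q-p∣ : ∀ p q → ∣ p - q ∣ ≡ ∣ q - p ∣
    ∣p-q∣≡∣q-p∣ p q = trans
      (cong ∣_∣ (minus-swap p q))
      (ℚ.∣-p∣≡∣p∣ (q - p))

    ∣p∣-∣q∣≤∣p-q∣ : ∀ p q → ∣ p ∣ - ∣ q ∣ ≤ ∣ p - q ∣
    ∣p∣-∣q∣≤∣p-q∣ p q = begin
      ∣ p ∣ - ∣ q ∣               ≤⟨ ℚ.+-monoˡ-≤ (- ∣ q ∣) (∣p∣≤∣q∣+∣p-q∣ p q) ⟩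
      ∣ q ∣ + ∣ p - q ∣ - ∣ q ∣   ≡⟨ cancel ∣ q ∣ ∣ p - q ∣ ⟩
      ∣ p - q ∣                   ∎

    ∣∣p∣-∣q∣∣≤∣p-q∣ : ∀ p q → ∣ ∣ p ∣ - ∣ q ∣ ∣ ≤ ∣ p - q ∣
    ∣∣p∣-∣q∣∣≤∣p-q∣ p q with ℚ.∣p∣≡p∨∣p∣≡-p (∣ p ∣ - ∣ q ∣)
    ... | inj₁ eq = subst (_≤ ∣ p - q ∣) (sym eq) (∣p∣-∣q∣≤∣p-q∣ p q)
    ... | inj₂ eq = subst₂ _≤_
      (sym (trans eq (sym (minus-swap ∣ q ∣ ∣ p ∣))))
      (∣p-q∣≡∣q-p∣ q p)
      (∣p∣-∣q∣≤∣p-q∣ q p)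

    0<1 : 0ℚ < 1ℚ
    0<1 = ℚ.positive⁻¹ 1ℚ

    halve : ∀ ε → 0ℚ < ε → ∃[ δ ] 0ℚ < δ × δ + δ ≡ ε
    halve ε 0<ε =
      let δ , 0<δ , eq = split 1ℚ 0<1 ε 0<ε
      in δ , 0<δ , trans (sym (ℚ.*-identityˡ (δ + δ))) eq

  fromℚ-cauchy : ∀ q → IsCauchy (λ _ → q)
  fromℚ-cauchy q ε 0<ε = 0 , λ _ _ _ _ →
    subst (λ p → ∣ p ∣ < ε) (sym (ℚ.+-inverseʳ q)) 0<ε

  +-cauchy : ∀ s t → IsCauchy s → IsCauchy t → IsCauchy (λ n → s n + t n)
  +-cauchy s t cs ct ε 0<ε =
    let δ , 0<δ , eq = halve ε 0<ε
        M , p = cs δ 0<δ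
        N , q = ct δ 0<δ
    in M ℕ.⊔ N , λ m n m≥ n≥ → begin-strict
      ∣ s m + t m - (s n + t n) ∣     ≡⟨ cong ∣_∣ (+-minus (s m) (t m) (s n) (t n)) ⟩
      ∣ (s m - s n) + (t m - t n) ∣   ≤⟨ ℚ.∣p+q∣≤∣p∣+∣q∣ (s m - s n) (t m - t n) ⟩
      ∣ s m - s n ∣ + ∣ t m - t n ∣   <⟨ ℚ.+-mono-<
        (p m n (ℕ.m⊔n≤o⇒m≤o M N m≥) (ℕ.m⊔n≤o⇒m≤o M N n≥))
        (q m n (ℕ.m⊔n≤o⇒n≤o M N m≥) (ℕ.m⊔n≤o⇒n≤o M N n≥)) ⟩
      δ + δ                           ≡⟨ eq ⟩
      ε                               ∎

  neg-cauchy : ∀ s → IsCauchy s → IsCauchy (λ n → - s n)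
  neg-cauchy s cs ε 0<ε =
    let N , p = cs ε 0<ε
    in N , λ m n m≥ n≥ → begin-strict
      ∣ - s m - - s n ∣     ≡⟨ cong ∣_∣ (sym (neg-minus (s m) (s n))) ⟩
      ∣ - (s m - s n) ∣     ≡⟨ ℚ.∣-p∣≡∣p∣ (s m - s n) ⟩
      ∣ s m - s n ∣         <⟨ p m n m≥ n≥ ⟩
      ε                     ∎

  abs-cauchy : ∀ s → IsCauchy s → IsCauchy (λ n → ∣ s n ∣)
  abs-cauchy s cs ε 0<ε =
    let N , p = cs ε 0<ε
    in N , λ m n m≥ n≥ →
      ℚ.≤-<-trans (∣∣p∣-∣q∣∣≤∣p-q∣ (s m) (s n)) (p m n m≥ n≥)

  private
    eventually-bounded : ∀ s → IsCauchy s →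
      Σ[ K ∈ ℚ ] 0ℚ < K × (∃[ N ] ∀ m → N ℕ.≤ m → ∣ s m ∣ ≤ K)
    eventually-bounded s cs =
      let N , p = cs 1ℚ 0<1
      in ∣ s N ∣ + 1ℚ
       , ℚ.+-mono-≤-< (ℚ.0≤∣p∣ (s N)) 0<1
       , N , λ m m≥ → begin
           ∣ s m ∣                   ≤⟨ ∣p∣≤∣q∣+∣p-q∣ (s m) (s N) ⟩
           ∣ s N ∣ + ∣ s m - s N ∣   ≤⟨ ℚ.+-monoʳ-≤ ∣ s N ∣ (ℚ.<⇒≤ (p m N m≥ ℕ.≤-refl)) ⟩
           ∣ s N ∣ + 1ℚ              ∎

    *-step : ∀ K L ε δ → 0ℚ < K → 0ℚ < L → (K + L) * (δ + δ) ≡ ε →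
             ∀ a b c d → ∣ a ∣ ≤ K → ∣ d ∣ ≤ L → ∣ a - c ∣ < δ → ∣ b - d ∣ < δ →
             ∣ a * b - c * d ∣ < ε
    *-step K L ε δ 0<K 0<L eq a b c d a≤K d≤L ac bd = begin-strict
      ∣ a * b - c * d ∣                           ≡⟨ cong ∣_∣ (*-minus a b c d) ⟩
      ∣ a * (b - d) + d * (a - c) ∣               ≤⟨ ℚ.∣p+q∣≤∣p∣+∣q∣ (a * (b - d)) (d * (a - c)) ⟩
      ∣ a * (b - d) ∣ + ∣ d * (a - c) ∣           ≡⟨ cong₂ _+_ (ℚ.∣p*q∣≡∣p∣*∣q∣ a (b - d)) (ℚ.∣p*q∣≡∣p∣*∣q∣ d (a - c)) ⟩
      ∣ a ∣ * ∣ b - d ∣ + ∣ d ∣ * ∣ a - c ∣       ≤⟨ ℚ.+-mono-≤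
        (ℚ.*-monoʳ-≤-nonNeg ∣ b - d ∣ {{ℚ.∣-∣-nonNeg (b - d)}} (ℚ.≤-trans a≤K K≤))
        (ℚ.*-monoʳ-≤-nonNeg ∣ a - c ∣ {{ℚ.∣-∣-nonNeg (a - c)}} (ℚ.≤-trans d≤L L≤)) ⟩
      (K + L) * ∣ b - d ∣ + (K + L) * ∣ a - c ∣   ≡⟨ sym (ℚ.*-distribˡ-+ (K + L) ∣ b - d ∣ ∣ a - c ∣) ⟩
      (K + L) * (∣ b - d ∣ + ∣ a - c ∣)           <⟨ ℚ.*-monoʳ-<-pos (K + L) {{positive 0<K+L}} (ℚ.+-mono-< bd ac) ⟩
      (K + L) * (δ + δ)                           ≡⟨ eq ⟩
      ε                                           ∎
      where
      0<K+L : 0ℚ < K + L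
      0<K+L = ℚ.+-mono-< 0<K 0<L
      K≤ : K ≤ K + L
      K≤ = subst (_≤ K + L) (ℚ.+-identityʳ K) (ℚ.+-monoʳ-≤ K (ℚ.<⇒≤ 0<L))
      L≤ : L ≤ K + L
      L≤ = subst (_≤ K + L) (ℚ.+-identityˡ L) (ℚ.+-monoˡ-≤ L (ℚ.<⇒≤ 0<K))

  *-cauchy : ∀ s t → IsCauchy s → IsCauchy t → IsCauchy (λ n → s n * t n)
  *-cauchy s t cs ct ε 0<ε =
    let K , 0<K , A , s≤K = eventually-bounded s cs
        L , 0<L , B , t≤L = eventually-bounded t ct
        δ , 0<δ , eq = split (K + L) (ℚ.+-mono-< 0<K 0<L) ε 0<ε
        M , p = cs δ 0<δ
        N , q = ct δ 0<δ
        AB = A ℕ.⊔ B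
        MN = M ℕ.⊔ N
    in AB ℕ.⊔ MN , λ m n m≥ n≥ →
      *-step K L ε δ 0<K 0<L eq (s m) (t m) (s n) (t n)
        (s≤K m (ℕ.m⊔n≤o⇒m≤o A B (ℕ.m⊔n≤o⇒m≤o AB MN m≥)))
        (t≤L n (ℕ.m⊔n≤o⇒n≤o A B (ℕ.m⊔n≤o⇒m≤o AB MN n≥)))
        (p m n (ℕ.m⊔n≤o⇒m≤o M N (ℕ.m⊔n≤o⇒n≤o AB MN m≥)) (ℕ.m⊔n≤o⇒m≤o M N (ℕ.m⊔n≤o⇒n≤o AB MN n≥)))
        (q m n (ℕ.m⊔n≤o⇒n≤o M N (ℕ.m⊔n≤o⇒n≤o AB MN m≥)) (ℕ.m⊔n≤o⇒n≤o M N (ℕ.m⊔n≤o⇒n≤o AB MN n≥)))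

infix 4 _≃_ _≤_ _<_

_≃_ : ℝ → ℝ → Set
x ≃ y = ∀ ε → 0ℚ ℚ.< ε →
  ∃[ N ] ∀ n → N ℕ.≤ n → ℚ.∣ seq x n ℚ.- seq y n ∣ ℚ.< ε

_≤_ : ℝ → ℝ → Set
x ≤ y = ∀ ε → 0ℚ ℚ.< ε →
  ∃[ N ] ∀ n → N ℕ.≤ n → seq x n ℚ.< seq y n ℚ.+ ε

_<_ : ℝ → ℝ → Set
x < y = ∃[ ε ] 0ℚ ℚ.< ε ×
  (∃[ N ] ∀ n → N ℕ.≤ n → seq x n ℚ.+ ε ℚ.< seq y n)

infixl 6 _+_ _-_
infixl 7 _*_ _/_
infix  8 -_

fromℚ : ℚ → ℝ
fromℚ q = mkℝ (λ _ → q) (fromℚ-cauchy q)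

fromℕ : ℕ → ℝ
fromℕ n = fromℚ (ℤ.+ n ℚ./ 1)

0ℝ 1ℝ : ℝ
0ℝ = fromℚ 0ℚ
1ℝ = fromℚ 1ℚ

_+_ : ℝ → ℝ → ℝ
x + y = mkℝ (λ n → seq x n ℚ.+ seq y n) (+-cauchy (seq x) (seq y) (cauchy x) (cauchy y))

-_ : ℝ → ℝ
- x = mkℝ (λ n → ℚ.- seq x n) (neg-cauchy (seq x) (cauchy x))

_-_ : ℝ → ℝ → ℝ
x - y = x + - y

_*_ : ℝ → ℝ → ℝ
x * y = mkℝ (λ n → seq x n ℚ.* seq y n) (*-cauchy (seq x) (seq y) (cauchy x) (cauchy y))

∣_∣ : ℝ → ℝ
∣ x ∣ = mkℝ (λ n → ℚ.∣ seq x n ∣) (abs-cauchy (seq x) (cauchy x))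

-- Only division by positive integers is needed.
_/_ : ℝ → (n : ℕ) .{{_ : NonZero n}} → ℝ
x / n = x * fromℚ (ℤ.+ 1 ℚ./ n)

ℝ-rawRing : RawRing 0ℓ 0ℓ
ℝ-rawRing = record
  { Carrier = ℝ ; _≈_ = _≃_ ; _+_ = _+_ ; _*_ = _*_ ; -_ = -_ ; 0# = 0ℝ ; 1# = 1ℝ }

open import Algebra.Definitions.RawSemiring (RawRing.rawSemiring ℝ-rawRing) public
  using (sum; _^_)

-- ∑[0≤i≤ n ] f = f 0 + ⋯ + f n  and  ∑[1≤m≤ n ] f = f 1 + ⋯ + f n
∑[0≤i≤_] : ℕ → (ℕ → ℝ) → ℝ
∑[0≤i≤ n ] f = sum {suc n} (f ∘ toℕ)

∑[1≤m≤_] : ℕ → ((m : ℕ) .{{_ : NonZero m}} → ℝ) → ℝ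
∑[1≤m≤ n ] f = sum {n} (λ i → f (suc (toℕ i)))

record TaggedPartition (a b : ℝ) : Set where
  field
    size  : ℕ
    point : Fin (suc size) → ℝ
    tag   : Fin size → ℝ
    first : point zero ≃ a
    last  : point (Fin.fromℕ size) ≃ b
    lower : ∀ i → point (inject₁ i) ≤ tag i
    upper : ∀ i → tag i ≤ point (suc i)

  width : Fin size → ℝ
  width i = point (suc i) - point (inject₁ i)

  MeshBelow : ℝ → Set
  MeshBelow δ = ∀ i → width i < δ

  riemannSum : (ℝ → ℝ) → ℝ
  riemannSum f = sum (λ i → f (tag i) * width i)

-- "f is Riemann integrable on [a , b] with integral I"
IsIntegral : (a b : ℝ) → (ℝ → ℝ) → ℝ → Set
IsIntegral a b f I = ∀ ε → 0ℝ < ε → Σ[ δ ∈ ℝ ] 0ℝ < δ ×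
  ((P : TaggedPartition a b) → MeshBelow P δ → ∣ riemannSum P f - I ∣ < ε)
  where open TaggedPartition

falling : ℝ → ℕ → ℝ
falling z zero    = 1ℝ
falling z (suc n) = falling z n * (z - fromℕ n)

binom : ℝ → ℕ → ℝ
binom z n = (falling z n / n !) {{n ℕ.!≢0}}

-- The integral is a relation, so the polynomials are specified rather than
-- computed: c n x is required to be n! ∫₀¹ binom (t - x) n dt.
IsCauchyPolynomial₁ : (ℕ → ℝ → ℝ) → Set
IsCauchyPolynomial₁ c = ∀ n x → Σ[ I ∈ ℝ ]
  IsIntegral 0ℝ 1ℝ (λ t → binom (t - x) n) I × c n x ≃ fromℕ (n !) * I

IsCauchyPolynomial₂ : (ℕ → ℝ → ℝ) → Set
IsCauchyPolynomial₂ ĉ = ∀ n x → Σ[ I ∈ ℝ ]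
  IsIntegral 0ℝ 1ℝ (λ t → binom (x - t) n) I × ĉ n x ≃ fromℕ (n !) * I

PowerSeries : Set
PowerSeries = ℕ → ℝ

infix  4 _≋_
infixl 6 _⊖_
infixl 7 _⊛_

_≋_ : PowerSeries → PowerSeries → Set
f ≋ g = ∀ n → f n ≃ g n

_⊖_ : PowerSeries → PowerSeries → PowerSeries
(f ⊖ g) n = f n - g n

_⊛_ : PowerSeries → PowerSeries → PowerSeries
(f ⊛ g) n = ∑[0≤i≤ n ] (λ i → f i * g (n ∸ i))

-- egf a = Σ aₙ tⁿ / n!
egf : (ℕ → ℝ) → PowerSeries
egf a n = (a n / n !) {{n ℕ.!≢0}}

-- exp x = e^{xt}
exp : ℝ → PowerSeries
exp x = egf (x ^_)

𝟙 𝕥 : PowerSeries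
𝟙 zero = 1ℝ
𝟙 (suc _) = 0ℝ
𝕥 1 = 1ℝ
𝕥 _ = 0ℝ

-- t e^{xt} / (e^t - 1) = Σ Bₙ(x) tⁿ / n!, cleared of the denominator; this
-- determines B because e^t - 1 is t times an invertible series.
IsBernoulliPolynomial : (ℕ → ℝ → ℝ) → Set
IsBernoulliPolynomial B = ∀ x →
  𝕥 ⊛ exp x ≋ (exp 1ℝ ⊖ 𝟙) ⊛ egf (λ n → B n x)

stirling₂ : ℕ → ℕ → ℕ
stirling₂ zero    zero    = 1
stirling₂ zero    (suc m) = 0
stirling₂ (suc n) zero    = 0
stirling₂ (suc n) (suc m) = suc m ℕ.* stirling₂ n (suc m) ℕ.+ stirling₂ n m

-- For m > n the truncated n ∸ m leaves only the term i = 0, which vanishes.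
genStirling₂ : ℕ → ℕ → ℝ → ℝ
genStirling₂ n m x = ∑[0≤i≤ n ∸ m ] λ i →
  fromℕ (n C i) * fromℕ (stirling₂ (n ∸ i) m) * x ^ i

{-# OPTIONS --safe #-}
module Submission where

-- Write f ⋆ g for the product of exponential generating functions and let
-- G x m be the sequence with generating function e^{xt} (e^t − 1)^m / m!, whose
-- n-th term is the generalized Stirling number {n, m}_x.  Expanding
-- e^{(x+z)t} = e^{xt} (1 + (e^t − 1))^z gives Σ_m z(z−1)⋯(z−m+1) G x m n = (x + z)^n.
-- Averaging over t ∈ [0, 1] with z = t − x or z = −x − t turns the falling
-- factorial into the Cauchy number c_m(x) or ĉ_m(−x) and the right-hand side into
-- ν_n = 1/(n+1) or (−1)^n/(n+1).  With P = Σ_m c_{m+1}/(m+1) G x m, the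
-- relation (e^t − 1) G x m = (m+1) G x (m+1) gives (e^t − 1) P + e^{xt} = ν, and
-- multiplying by t and cancelling e^t − 1 yields t P + B(x) = κ, where κ is 1 or
-- e^{−t}; comparing coefficients is the theorem.
--
-- The only integrals that are evaluated are those of t^k, as limits of
-- left Riemann sums on uniform partitions.

open import Algebra.Bundles using (CommutativeRing)
open import Algebra.Bundles.Raw using (RawRing)
open import Algebra.Core using (Op₁; Op₂)
open import Algebra.Definitions using (Congruent₁)
open import Algebra.Structures
  using (IsMagma; IsSemigroup; IsMonoid; IsGroup; IsAbelianGroup; IsRing; IsCommutativeRing)
open import Data.Fin.Base as Fin using (Fin; toℕ; inject₁)
import Data.Fin.Properties as Fin
open import Data.Integer.Base as ℤ using (+_)
import Data.Integer.Properties as ℤ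
open import Data.Nat.Base as ℕ using (ℕ; zero; suc; NonZero; _!; _∸_; z≤n; s≤s)
open import Data.Nat.Combinatorics
  using (_C_; nCk≡n!/k![n-k]!; k>n⇒nCk≡0; k![n∸k]!∣n!; nCk+nC[k+1]≡[n+1]C[k+1])
open import Data.Nat.DivMod using (m/n*n≡m)
import Data.Nat.Properties as ℕ
open import Data.Nat.Tactic.RingSolver using (solve-∀)
open import Data.Product using (∃-syntax; _×_; _,_; proj₁; proj₂)
open import Data.Rational.Base as ℚ using (ℚ; 0ℚ; 1ℚ; mkℚ)
import Data.Rational.Properties as ℚ
open import Data.Rational.Solver using (module +-*-Solver)
open import Data.Rational.Unnormalised.Base as ℚᵘ using (mkℚᵘ; *≡*; *<*)
import Data.Rational.Unnormalised.Properties as ℚᵘ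
open import Data.Sum.Base using (inj₁; inj₂)
open import Data.Vec.Functional using (foldr)
open import Defs using (stirling₂)
open import Function.Base using (_∘_)
open import Level using (0ℓ)
open import Relation.Binary.Core using (Rel)
open import Relation.Binary.PropositionalEquality as ≡ using (_≡_; cong; cong₂; subst)
open import Relation.Binary.Structures using (IsEquivalence)

-- Two obstacles shape the proof. The Cauchy polynomials are known only through a relation with
-- Riemann integrals, and integrability of a combination of integrands would have to be argued
-- separately. Each hypothesis is therefore weakened at once to convergence along uniform
-- partitions: this relation is linear and single-valued, and its values on monomials follow from
-- power sums, so it suffices to compare coefficients. The second obstacle is that e^t - 1 has no
-- constant term and cannot be inverted. After multiplication by t every term is a multiple of e^t -
-- 1, and injectivity of that multiplication replaces division. The algebra is carried out in an
-- arbitrary commutative ring, with the averaging relation as a parameter, so that nothing in it can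
-- unfold to Cauchy sequences of rationals.

∑ℕ : ℕ → (ℕ → ℕ) → ℕ
∑ℕ zero    s = 0
∑ℕ (suc n) s = s 0 ℕ.+ ∑ℕ n (s ∘ suc)

-- Folding over `Fin n` makes this unfold to the library's `sum`, so that the library's lemmas
-- apply, while terms stay indexed by natural numbers.
bigop : {A : Set} → Op₂ A → A → ℕ → (ℕ → A) → A
bigop _∙_ ε n f = foldr _∙_ ε {n} (f ∘ toℕ)

power : {A : Set} → Op₂ A → A → A → ℕ → A
power _∙_ ε x zero    = ε
power _∙_ ε x (suc n) = x ∙ power _∙_ ε x n

module _ (R : RawRing 0ℓ 0ℓ) where
  private module R = RawRing R
  open import Algebra.Definitions.RawSemiring R.rawSemiring using (_^_)

  ^≡power : ∀ x n → x ^ n ≡ power R._*_ R.1# x n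
  ^≡power x zero    = ≡.refl
  ^≡power x (suc n) = ≡.cong (x R.*_) (^≡power x n)

-- The functional f ↦ Σⱼ f (node j) * weight, packaged so that it can be kept abstract.
record WeightedSum {A : Set} (_≈_ : Rel A 0ℓ) (_+_ _*_ : Op₂ A) (∑ : (ℕ → A) → A)
                   (node : ℕ → A) (weight : A) : Set where
  field
    apply      : (A → A) → A
    apply-def  : ∀ f → ∑ (λ j → f (node j) * weight) ≈ apply f
    apply-cong : ∀ f g → (∀ t → f t ≈ g t) → apply f ≈ apply g
    apply-+    : ∀ f g → apply (λ t → f t + g t) ≈ (apply f + apply g)
    apply-*    : ∀ c f → apply (λ t → c * f t) ≈ (c * apply f)

-- Umbral algebra over an abstract commutative ring

module Umbral {A : Set}
  (eq : Rel A 0ℓ) (add mul : Op₂ A) (neg : Op₁ A) (nought one : A)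
  (isCommutativeRing : IsCommutativeRing eq add mul neg nought one)
  (⟦_⟧ : ℕ → A)
  (⟦0⟧≈0 : eq ⟦ 0 ⟧ nought)
  (⟦suc⟧ : ∀ n → eq ⟦ suc n ⟧ (add one ⟦ n ⟧))
  where

  R : CommutativeRing 0ℓ 0ℓ
  R = record { isCommutativeRing = isCommutativeRing }

  open CommutativeRing R hiding (isCommutativeRing; zero)
  open import Algebra.Properties.Group +-group using (x∙y⁻¹≈ε⇒x≈y)
  open import Algebra.Properties.Ring ring using (-1*x≈-x; -0#≈0#; -‿distribˡ-*)
  open import Algebra.Properties.Semiring.Sum semiring
    using (sum; ∑-distrib-+; *-distribˡ-sum; sum-cong-≋)
  open import Algebra.Solver.Ring.NaturalCoefficients.Default commutativeSemiring
    using (solve; _:=_; _:+_; _:*_; con)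
  open import Relation.Binary.Reasoning.Setoid setoid

  infixr 8 _^_

  _^_ : A → ℕ → A
  _^_ = power mul one

  pow-zero : ∀ x → x ^ 0 ≈ 1#
  pow-zero x = refl

  pow-suc : ∀ x n → x ^ suc n ≈ x * x ^ n
  pow-suc x n = refl

  ⟦1⟧≈1 : ⟦ 1 ⟧ ≈ 1#
  ⟦1⟧≈1 = trans (⟦suc⟧ 0) (trans (+-congˡ ⟦0⟧≈0) (+-identityʳ 1#))

  ⟦+⟧ : ∀ m n → ⟦ m ℕ.+ n ⟧ ≈ ⟦ m ⟧ + ⟦ n ⟧
  ⟦+⟧ zero    n = sym (trans (+-congʳ ⟦0⟧≈0) (+-identityˡ ⟦ n ⟧))
  ⟦+⟧ (suc m) n = begin
    ⟦ suc (m ℕ.+ n) ⟧       ≈⟨ ⟦suc⟧ (m ℕ.+ n) ⟩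
    1# + ⟦ m ℕ.+ n ⟧        ≈⟨ +-congˡ (⟦+⟧ m n) ⟩
    1# + (⟦ m ⟧ + ⟦ n ⟧)    ≈⟨ +-assoc 1# ⟦ m ⟧ ⟦ n ⟧ ⟨
    (1# + ⟦ m ⟧) + ⟦ n ⟧    ≈⟨ +-congʳ (⟦suc⟧ m) ⟨
    ⟦ suc m ⟧ + ⟦ n ⟧       ∎

  ⟦*⟧ : ∀ m n → ⟦ m ℕ.* n ⟧ ≈ ⟦ m ⟧ * ⟦ n ⟧
  ⟦*⟧ zero    n = trans ⟦0⟧≈0 (sym (trans (*-congʳ ⟦0⟧≈0) (zeroˡ ⟦ n ⟧)))
  ⟦*⟧ (suc m) n = begin
    ⟦ n ℕ.+ m ℕ.* n ⟧       ≈⟨ ⟦+⟧ n (m ℕ.* n) ⟩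
    ⟦ n ⟧ + ⟦ m ℕ.* n ⟧     ≈⟨ +-congˡ (⟦*⟧ m n) ⟩
    ⟦ n ⟧ + ⟦ m ⟧ * ⟦ n ⟧   ≈⟨ solve 2 (λ m n → n :+ m :* n := (con 1 :+ m) :* n) refl ⟦ m ⟧ ⟦ n ⟧ ⟩
    (1# + ⟦ m ⟧) * ⟦ n ⟧    ≈⟨ *-congʳ (⟦suc⟧ m) ⟨
    ⟦ suc m ⟧ * ⟦ n ⟧       ∎

  ∑< : ℕ → (ℕ → A) → A
  ∑< = bigop add nought

  ∑<-cong : ∀ n {f g : ℕ → A} → (∀ i → i ℕ.< n → f i ≈ g i) → ∑< n f ≈ ∑< n g
  ∑<-cong n f≈g = sum-cong-≋ (λ i → f≈g (toℕ i) (Fin.toℕ<n i))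

  sum≈∑< : ∀ n (v : Fin n → A) (f : ℕ → A) → (∀ i → v i ≈ f (toℕ i)) → sum v ≈ ∑< n f
  sum≈∑< n v f v≈f = sum-cong-≋ v≈f

  ∑<-+ : ∀ n (f g : ℕ → A) → ∑< n (λ i → f i + g i) ≈ ∑< n f + ∑< n g
  ∑<-+ n f g = ∑-distrib-+ {n} (f ∘ toℕ) (g ∘ toℕ)

  ∑<-*ˡ : ∀ n c (f : ℕ → A) → ∑< n (λ i → c * f i) ≈ c * ∑< n f
  ∑<-*ˡ n c f = sym (*-distribˡ-sum {n} c (f ∘ toℕ))

  ∑<-0 : ∀ n {f : ℕ → A} → (∀ i → i ℕ.< n → f i ≈ 0#) → ∑< n f ≈ 0#
  ∑<-0 zero    f≈0 = refl
  ∑<-0 (suc n) f≈0 = trans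
    (+-cong (f≈0 0 (s≤s z≤n)) (∑<-0 n (λ i i<n → f≈0 (suc i) (s≤s i<n)))) (+-identityˡ 0#)

  ∑<-truncate : ∀ {k n} → k ℕ.≤ n → (f : ℕ → A) →
                (∀ i → k ℕ.≤ i → i ℕ.< n → f i ≈ 0#) → ∑< n f ≈ ∑< k f
  ∑<-truncate {n = n} z≤n       f f≈0 = ∑<-0 n (λ i → f≈0 i z≤n)
  ∑<-truncate         (s≤s k≤n) f f≈0 =
    +-congˡ (∑<-truncate k≤n (f ∘ suc) (λ i k≤i i<n → f≈0 (suc i) (s≤s k≤i) (s≤s i<n)))

  ∑<-hom : ∀ (h : ℕ → A) (s : ℕ → ℕ) → h 0 ≈ 0# → (∀ m n → h (m ℕ.+ n) ≈ h m + h n) →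
           ∀ n → ∑< n (h ∘ s) ≈ h (∑ℕ n s)
  ∑<-hom h s h-0 h-+ zero    = sym h-0
  ∑<-hom h s h-0 h-+ (suc n) = trans (+-congˡ (∑<-hom h (s ∘ suc) h-0 h-+ n)) (sym (h-+ (s 0) (∑ℕ n (s ∘ suc))))

  ^-hom : ∀ {B : Set} (h : B → A) (_∙_ : Op₂ B) ε → h ε ≈ 1# → (∀ a b → h (a ∙ b) ≈ h a * h b) →
          ∀ b n → h (power _∙_ ε b n) ≈ h b ^ n
  ^-hom h _∙_ ε h-ε h-∙ b zero    = h-ε
  ^-hom h _∙_ ε h-ε h-∙ b (suc n) = trans (h-∙ b (power _∙_ ε b n)) (*-congˡ (^-hom h _∙_ ε h-ε h-∙ b n))

  equallyWeighted : ∀ node weight n → WeightedSum eq add mul (∑< n) node weight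
  equallyWeighted node weight n = record
    { apply      = λ f → ∑< n (λ j → f (node j) * weight)
    ; apply-def  = λ f → refl
    ; apply-cong = λ f g f≈g → ∑<-cong n (λ j _ → *-congʳ (f≈g (node j)))
    ; apply-+    = λ f g → trans
        (∑<-cong n (λ j _ → distribʳ weight (f (node j)) (g (node j))))
        (∑<-+ n (λ j → f (node j) * weight) (λ j → g (node j) * weight))
    ; apply-*    = λ c f → trans
        (∑<-cong n (λ j _ → *-assoc c (f (node j)) weight))
        (∑<-*ˡ n c (λ j → f (node j) * weight))
    }

  apply-hom : ∀ {n node weight} (W : WeightedSum eq add mul (∑< n) node weight) f (h : ℕ → A) (s : ℕ → ℕ) →
              (∀ j → eq (mul (f (node j)) weight) (h (s j))) →
              eq (h 0) nought → (∀ m n → eq (h (m ℕ.+ n)) (add (h m) (h n))) →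
              eq (WeightedSum.apply W f) (h (∑ℕ n s))
  apply-hom {n} W f h s term h-0 h-+ = trans (sym (WeightedSum.apply-def W f))
    (trans (∑<-cong n (λ j _ → term j)) (∑<-hom h s h-0 h-+ n))

  -- Exponential generating functions, with the shift `D` as differentiation

  D : (ℕ → A) → ℕ → A
  D f = f ∘ suc

  infixl 7 _⋆_

  -- The sequence of Taylor coefficients of the product of the exponential
  -- generating functions of f and g, defined by the Leibniz rule.
  _⋆_ : (ℕ → A) → (ℕ → A) → ℕ → A
  (f ⋆ g) zero    = f 0 * g 0
  (f ⋆ g) (suc n) = (D f ⋆ g) n + (f ⋆ D g) n

  -- The bound on the indices matters in `X⋆cauchySum`, where two sequences agree only up to the
  -- coefficient under consideration.
  ⋆-cong-≤ : ∀ n {f f′ g g′ : ℕ → A} → (∀ i → i ℕ.≤ n → f i ≈ f′ i) →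
             (∀ i → i ℕ.≤ n → g i ≈ g′ i) → (f ⋆ g) n ≈ (f′ ⋆ g′) n
  ⋆-cong-≤ zero    f≈f′ g≈g′ = *-cong (f≈f′ 0 z≤n) (g≈g′ 0 z≤n)
  ⋆-cong-≤ (suc n) f≈f′ g≈g′ = +-cong
    (⋆-cong-≤ n (λ i i≤n → f≈f′ (suc i) (s≤s i≤n)) (λ i i≤n → g≈g′ i (ℕ.m≤n⇒m≤1+n i≤n)))
    (⋆-cong-≤ n (λ i i≤n → f≈f′ i (ℕ.m≤n⇒m≤1+n i≤n)) (λ i i≤n → g≈g′ (suc i) (s≤s i≤n)))

  ⋆-congˡ : ∀ n {f g g′ : ℕ → A} → (∀ i → g i ≈ g′ i) → (f ⋆ g) n ≈ (f ⋆ g′) n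
  ⋆-congˡ n g≈g′ = ⋆-cong-≤ n (λ _ _ → refl) (λ i _ → g≈g′ i)

  ⋆-congʳ : ∀ n {f f′ g : ℕ → A} → (∀ i → f i ≈ f′ i) → (f ⋆ g) n ≈ (f′ ⋆ g) n
  ⋆-congʳ n f≈f′ = ⋆-cong-≤ n (λ i _ → f≈f′ i) (λ _ _ → refl)

  ⋆-comm : ∀ n (f g : ℕ → A) → (f ⋆ g) n ≈ (g ⋆ f) n
  ⋆-comm zero    f g = *-comm (f 0) (g 0)
  ⋆-comm (suc n) f g = trans (+-cong (⋆-comm n (D f) g) (⋆-comm n f (D g)))
    (+-comm ((g ⋆ D f) n) ((D g ⋆ f) n))

  ⋆-distribˡ-+ : ∀ n (f g h : ℕ → A) → (f ⋆ (λ i → g i + h i)) n ≈ (f ⋆ g) n + (f ⋆ h) n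
  ⋆-distribˡ-+ zero    f g h = distribˡ (f 0) (g 0) (h 0)
  ⋆-distribˡ-+ (suc n) f g h = trans
    (+-cong (⋆-distribˡ-+ n (D f) g h) (⋆-distribˡ-+ n f (D g) (D h)))
    (solve 4 (λ a b c d → (a :+ b) :+ (c :+ d) := (a :+ c) :+ (b :+ d)) refl
      ((D f ⋆ g) n) ((D f ⋆ h) n) ((f ⋆ D g) n) ((f ⋆ D h) n))

  ⋆-distribʳ-+ : ∀ n (f g h : ℕ → A) → ((λ i → f i + g i) ⋆ h) n ≈ (f ⋆ h) n + (g ⋆ h) n
  ⋆-distribʳ-+ n f g h = begin
    ((λ i → f i + g i) ⋆ h) n   ≈⟨ ⋆-comm n (λ i → f i + g i) h ⟩
    (h ⋆ (λ i → f i + g i)) n   ≈⟨ ⋆-distribˡ-+ n h f g ⟩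
    (h ⋆ f) n + (h ⋆ g) n       ≈⟨ +-cong (⋆-comm n h f) (⋆-comm n h g) ⟩
    (f ⋆ h) n + (g ⋆ h) n       ∎

  ⋆-*ʳ : ∀ n c (f g : ℕ → A) → (f ⋆ (λ i → c * g i)) n ≈ c * (f ⋆ g) n
  ⋆-*ʳ zero    c f g = solve 3 (λ c f g → f :* (c :* g) := c :* (f :* g)) refl c (f 0) (g 0)
  ⋆-*ʳ (suc n) c f g = trans (+-cong (⋆-*ʳ n c (D f) g) (⋆-*ʳ n c f (D g)))
    (sym (distribˡ c ((D f ⋆ g) n) ((f ⋆ D g) n)))

  ⋆-*ˡ : ∀ n c (f g : ℕ → A) → ((λ i → c * f i) ⋆ g) n ≈ c * (f ⋆ g) n
  ⋆-*ˡ n c f g = begin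
    ((λ i → c * f i) ⋆ g) n   ≈⟨ ⋆-comm n (λ i → c * f i) g ⟩
    (g ⋆ (λ i → c * f i)) n   ≈⟨ ⋆-*ʳ n c g f ⟩
    c * (g ⋆ f) n             ≈⟨ *-congˡ (⋆-comm n g f) ⟩
    c * (f ⋆ g) n             ∎

  ⋆-zeroʳ : ∀ n (f : ℕ → A) → (f ⋆ (λ _ → 0#)) n ≈ 0#
  ⋆-zeroʳ zero    f = zeroʳ (f 0)
  ⋆-zeroʳ (suc n) f = trans (+-cong (⋆-zeroʳ n (D f)) (⋆-zeroʳ n f)) (+-identityˡ 0#)

  ⋆-∑< : ∀ k n (f : ℕ → A) (g : ℕ → ℕ → A) →
         (f ⋆ (λ i → ∑< k (λ m → g m i))) n ≈ ∑< k (λ m → (f ⋆ g m) n)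
  ⋆-∑< zero    n f g = ⋆-zeroʳ n f
  ⋆-∑< (suc k) n f g = trans (⋆-distribˡ-+ n f (g 0) (λ i → ∑< k (λ m → g (suc m) i)))
    (+-congˡ (⋆-∑< k n f (g ∘ suc)))

  δ : ℕ → A
  δ zero    = 1#
  δ (suc _) = 0#

  ⋆-identityʳ : ∀ n (f : ℕ → A) → (f ⋆ δ) n ≈ f n
  ⋆-identityʳ zero    f = *-identityʳ (f 0)
  ⋆-identityʳ (suc n) f = trans (+-cong (⋆-identityʳ n (D f)) (⋆-zeroʳ n f)) (+-identityʳ (f (suc n)))

  -- e^t - 1
  X : ℕ → A
  X zero    = 0#
  X (suc _) = 1#

  -- The Leibniz rule together with (e^t - 1)′ = (e^t - 1) + 1.
  X⋆-suc : ∀ n (f : ℕ → A) → (X ⋆ f) (suc n) ≈ ((X ⋆ f) n + f n) + (X ⋆ D f) n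
  X⋆-suc n f = +-congʳ (begin
    (D X ⋆ f) n               ≈⟨ ⋆-congʳ n DX≈X+δ ⟩
    ((λ i → X i + δ i) ⋆ f) n ≈⟨ ⋆-distribʳ-+ n X δ f ⟩
    (X ⋆ f) n + (δ ⋆ f) n     ≈⟨ +-congˡ (trans (⋆-comm n δ f) (⋆-identityʳ n f)) ⟩
    (X ⋆ f) n + f n           ∎)
    where
    DX≈X+δ : ∀ i → D X i ≈ X i + δ i
    DX≈X+δ zero    = sym (+-identityˡ 1#)
    DX≈X+δ (suc i) = sym (+-identityʳ 1#)

  ⋆-lowest : ∀ n (f g : ℕ → A) → (∀ i → i ℕ.< n → g i ≈ 0#) → (f ⋆ g) n ≈ f 0 * g n
  ⋆-lowest zero    f g g≈0 = refl
  ⋆-lowest (suc n) f g g≈0 = begin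
    (D f ⋆ g) n + (f ⋆ D g) n      ≈⟨ +-cong (⋆-lowest n (D f) g (λ i i<n → g≈0 i (ℕ.m<n⇒m<1+n i<n)))
                                             (⋆-lowest n f (D g) (λ i i<n → g≈0 (suc i) (s≤s i<n))) ⟩
    f 1 * g n + f 0 * g (suc n)    ≈⟨ +-congʳ (trans (*-congˡ (g≈0 n ℕ.≤-refl)) (zeroʳ (f 1))) ⟩
    0# + f 0 * g (suc n)           ≈⟨ +-identityˡ (f 0 * g (suc n)) ⟩
    f 0 * g (suc n)                ∎

  -- Since e^t - 1 = t + ⋯, the lowest term of `g` meets only the linear term t; the factor is the
  -- binomial coefficient of n + 1 over 1. This is what makes multiplication by e^t - 1 injective.
  X⋆-lowest : ∀ n (g : ℕ → A) → (∀ i → i ℕ.< n → g i ≈ 0#) → (X ⋆ g) (suc n) ≈ ⟦ suc n ⟧ * g n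
  X⋆-lowest zero    g g≈0 = begin
    1# * g 0 + 0# * g 1   ≈⟨ solve 2 (λ a b → con 1 :* a :+ con 0 :* b := con 1 :* a) refl (g 0) (g 1) ⟩
    1# * g 0              ≈⟨ *-congʳ ⟦1⟧≈1 ⟨
    ⟦ 1 ⟧ * g 0           ∎
  X⋆-lowest (suc n) g g≈0 = begin
    (D X ⋆ g) (suc n) + (X ⋆ D g) (suc n)
      ≈⟨ +-cong (⋆-lowest (suc n) (D X) g g≈0) (X⋆-lowest n (D g) (λ i i<n → g≈0 (suc i) (s≤s i<n))) ⟩
    1# * g (suc n) + ⟦ suc n ⟧ * g (suc n)
      ≈⟨ distribʳ (g (suc n)) 1# ⟦ suc n ⟧ ⟨
    (1# + ⟦ suc n ⟧) * g (suc n)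
      ≈⟨ *-congʳ (⟦suc⟧ (suc n)) ⟨
    ⟦ suc (suc n) ⟧ * g (suc n) ∎

  -- T f is t times f.
  T : (ℕ → A) → ℕ → A
  T f zero    = 0#
  T f (suc n) = ⟦ suc n ⟧ * f n

  T-cong : ∀ n {f g : ℕ → A} → (∀ i → f i ≈ g i) → T f n ≈ T g n
  T-cong zero    f≈g = refl
  T-cong (suc n) f≈g = *-congˡ (f≈g n)

  T-+ : ∀ n (f g : ℕ → A) → T (λ i → f i + g i) n ≈ T f n + T g n
  T-+ zero    f g = sym (+-identityˡ 0#)
  T-+ (suc n) f g = distribˡ ⟦ suc n ⟧ (f n) (g n)

  -- Induction through the derivative, using (t g)′ = t g′ + g.
  ⋆-T : ∀ n (f g : ℕ → A) → (f ⋆ T g) n ≈ T (f ⋆ g) n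
  ⋆-T zero    f g = zeroʳ (f 0)
  ⋆-T (suc n) f g = begin
    (D f ⋆ T g) n + (f ⋆ D (T g)) n
      ≈⟨ +-congˡ (⋆-congˡ n D-T) ⟩
    (D f ⋆ T g) n + (f ⋆ (λ i → T (D g) i + g i)) n
      ≈⟨ +-congˡ (⋆-distribˡ-+ n f (T (D g)) g) ⟩
    (D f ⋆ T g) n + ((f ⋆ T (D g)) n + (f ⋆ g) n)
      ≈⟨ +-cong (⋆-T n (D f) g) (+-congʳ (⋆-T n f (D g))) ⟩
    T (D f ⋆ g) n + (T (f ⋆ D g) n + (f ⋆ g) n)
      ≈⟨ collect n ⟩
    ⟦ suc n ⟧ * (f ⋆ g) n ∎
    where
    D-T : ∀ i → D (T g) i ≈ T (D g) i + g i
    D-T zero    = trans (*-congʳ ⟦1⟧≈1) (trans (*-identityˡ (g 0)) (sym (+-identityˡ (g 0))))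
    D-T (suc i) = trans (*-congʳ (⟦suc⟧ (suc i)))
      (solve 2 (λ a b → (con 1 :+ a) :* b := a :* b :+ b) refl ⟦ suc i ⟧ (g (suc i)))
    collect : ∀ n → T (D f ⋆ g) n + (T (f ⋆ D g) n + (f ⋆ g) n) ≈ ⟦ suc n ⟧ * (f ⋆ g) n
    collect zero    = trans
      (solve 1 (λ a → con 0 :+ (con 0 :+ a) := con 1 :* a) refl (f 0 * g 0)) (*-congʳ (sym ⟦1⟧≈1))
    collect (suc n) = trans
      (solve 3 (λ k a b → k :* a :+ (k :* b :+ (a :+ b)) := (con 1 :+ k) :* (a :+ b)) refl
        ⟦ suc n ⟧ ((D f ⋆ g) n) ((f ⋆ D g) n))
      (*-congʳ (sym (⟦suc⟧ (suc n))))

  nCk*[k!*[n∸k]!]≡n! : ∀ {n k} → k ℕ.≤ n → (n C k) ℕ.* (k ! ℕ.* (n ∸ k) !) ≡ n !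
  nCk*[k!*[n∸k]!]≡n! {n} {k} k≤n =
    ≡.trans (≡.cong (ℕ._* (k ! ℕ.* (n ∸ k) !)) (nCk≡n!/k![n-k]! k≤n)) (m/n*n≡m (k![n∸k]!∣n! k≤n))
    where instance _ = k ℕ.!* (n ∸ k) !≢0

  -- Pascal's rule for the coefficients is the Leibniz rule for the product: `v` collects the terms
  -- that differentiate `f`, `w` those that differentiate `g`.
  ⋆-binomial : ∀ n (f g : ℕ → A) →
               ∑< (suc n) (λ i → ⟦ n C i ⟧ * (f i * g (n ∸ i))) ≈ (f ⋆ g) n
  ⋆-binomial zero    f g = begin
    ⟦ 1 ⟧ * (f 0 * g 0) + 0#   ≈⟨ +-identityʳ _ ⟩
    ⟦ 1 ⟧ * (f 0 * g 0)        ≈⟨ *-congʳ ⟦1⟧≈1 ⟩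
    1# * (f 0 * g 0)           ≈⟨ *-identityˡ (f 0 * g 0) ⟩
    f 0 * g 0                  ∎
  ⋆-binomial (suc n) f g = begin
    w 0 + ∑< (suc n) (λ i → ⟦ suc n C suc i ⟧ * (f (suc i) * g (n ∸ i)))
      ≈⟨ +-congˡ (∑<-cong (suc n) (λ i _ → pascal i)) ⟩
    w 0 + ∑< (suc n) (λ i → v i + w (suc i))
      ≈⟨ +-congˡ (∑<-+ (suc n) v (w ∘ suc)) ⟩
    w 0 + (∑< (suc n) v + ∑< (suc n) (w ∘ suc))
      ≈⟨ solve 3 (λ a b c → a :+ (b :+ c) := b :+ (a :+ c)) refl (w 0) (∑< (suc n) v) (∑< (suc n) (w ∘ suc)) ⟩
    ∑< (suc n) v + ∑< (suc (suc n)) w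
      -- The top term i = n + 1 of `w` carries the binomial coefficient of n over n + 1, which is 0.
      ≈⟨ +-congˡ (∑<-truncate (ℕ.n≤1+n (suc n)) w λ i n<i _ → vanish i n<i) ⟩
    ∑< (suc n) v + ∑< (suc n) w
      ≈⟨ +-congˡ (∑<-cong (suc n) λ i i<1+n → *-congˡ {⟦ n C i ⟧} (*-congˡ {f i}
           (reflexive (≡.cong g (ℕ.+-∸-assoc 1 (ℕ.≤-pred i<1+n)))))) ⟩
    ∑< (suc n) v + ∑< (suc n) (λ i → ⟦ n C i ⟧ * (f i * D g (n ∸ i)))
      ≈⟨ +-cong (⋆-binomial n (D f) g) (⋆-binomial n f (D g)) ⟩
    (D f ⋆ g) n + (f ⋆ D g) n ∎
    where
    v w : ℕ → A
    v i = ⟦ n C i ⟧ * (D f i * g (n ∸ i))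
    w i = ⟦ n C i ⟧ * (f i * g (suc n ∸ i))
    pascal : ∀ i → ⟦ suc n C suc i ⟧ * (f (suc i) * g (n ∸ i)) ≈ v i + w (suc i)
    pascal i = trans
      (*-congʳ (trans (reflexive (≡.cong ⟦_⟧ (≡.sym (nCk+nC[k+1]≡[n+1]C[k+1] n i)))) (⟦+⟧ (n C i) (n C suc i))))
      (distribʳ _ ⟦ n C i ⟧ ⟦ n C suc i ⟧)
    vanish : ∀ i → n ℕ.< i → w i ≈ 0#
    vanish i n<i = trans (*-congʳ (trans (reflexive (≡.cong ⟦_⟧ (k>n⇒nCk≡0 n<i))) ⟦0⟧≈0)) (zeroˡ _)

  -- Generalized Stirling numbers

  -- G x m has exponential generating function e^{xt} (e^t - 1)^m / m!, which
  -- determines the recurrences and X⋆G below.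
  G : A → ℕ → ℕ → A
  G x m = (x ^_) ⋆ (λ n → ⟦ stirling₂ n m ⟧)

  private
    S : ℕ → ℕ → A
    S m n = ⟦ stirling₂ n m ⟧

  D-pow-⋆ : ∀ x n (f : ℕ → A) → (D (x ^_) ⋆ f) n ≈ x * ((x ^_) ⋆ f) n
  D-pow-⋆ x n f = trans (⋆-congʳ n (pow-suc x)) (⋆-*ˡ n x (x ^_) f)

  G-zero-zero : ∀ x → G x 0 0 ≈ 1#
  G-zero-zero x = trans (*-cong (pow-zero x) ⟦1⟧≈1) (*-identityˡ 1#)

  G-suc-zero : ∀ x m → G x (suc m) 0 ≈ 0#
  G-suc-zero x m = trans (*-congˡ ⟦0⟧≈0) (zeroʳ (x ^ 0))

  G-zero-suc : ∀ x n → G x 0 (suc n) ≈ x * G x 0 n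
  G-zero-suc x n = trans
    (+-cong (D-pow-⋆ x n (S 0)) (trans (⋆-congˡ n (λ _ → ⟦0⟧≈0)) (⋆-zeroʳ n (x ^_))))
    (+-identityʳ (x * G x 0 n))

  G-suc-suc : ∀ x m n → G x (suc m) (suc n) ≈ (x + ⟦ suc m ⟧) * G x (suc m) n + G x m n
  G-suc-suc x m n = begin
    (D (x ^_) ⋆ S (suc m)) n + ((x ^_) ⋆ D (S (suc m))) n
      ≈⟨ +-cong (D-pow-⋆ x n (S (suc m)))
           (⋆-congˡ n (λ i → trans (⟦+⟧ (suc m ℕ.* stirling₂ i (suc m)) (stirling₂ i m)) (+-congʳ (⟦*⟧ (suc m) (stirling₂ i (suc m)))))) ⟩
    x * G x (suc m) n + ((x ^_) ⋆ (λ i → ⟦ suc m ⟧ * S (suc m) i + S m i)) n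
      ≈⟨ +-congˡ (⋆-distribˡ-+ n (x ^_) (λ i → ⟦ suc m ⟧ * S (suc m) i) (S m)) ⟩
    x * G x (suc m) n + (((x ^_) ⋆ (λ i → ⟦ suc m ⟧ * S (suc m) i)) n + G x m n)
      ≈⟨ +-congˡ (+-congʳ (⋆-*ʳ n ⟦ suc m ⟧ (x ^_) (S (suc m)))) ⟩
    x * G x (suc m) n + (⟦ suc m ⟧ * G x (suc m) n + G x m n)
      ≈⟨ solve 4 (λ x k g h → x :* g :+ (k :* g :+ h) := (x :+ k) :* g :+ h) refl x ⟦ suc m ⟧ (G x (suc m) n) (G x m n) ⟩
    (x + ⟦ suc m ⟧) * G x (suc m) n + G x m n ∎

  G-zero : ∀ x n → G x 0 n ≈ x ^ n
  G-zero x zero    = trans (G-zero-zero x) (sym (pow-zero x))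
  G-zero x (suc n) = trans (G-zero-suc x n) (trans (*-congˡ (G-zero x n)) (sym (pow-suc x n)))

  G-vanish : ∀ x {m n} → n ℕ.< m → G x m n ≈ 0#
  G-vanish x {suc m} {zero}  _         = G-suc-zero x m
  G-vanish x {suc m} {suc n} (s≤s n<m) = begin
    G x (suc m) (suc n)
      ≈⟨ G-suc-suc x m n ⟩
    (x + ⟦ suc m ⟧) * G x (suc m) n + G x m n
      ≈⟨ +-cong (*-congˡ (G-vanish x (ℕ.m<n⇒m<1+n n<m))) (G-vanish x n<m) ⟩
    (x + ⟦ suc m ⟧) * 0# + 0#
      ≈⟨ +-identityʳ _ ⟩
    (x + ⟦ suc m ⟧) * 0#
      ≈⟨ zeroʳ (x + ⟦ suc m ⟧) ⟩
    0# ∎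

  -- As `G` is built from Stirling numbers and not from powers of e^t - 1, the relation comes by
  -- induction on n: after differentiation both sides satisfy the same recurrence, which refers to m
  -- and m - 1 at the index n.
  X⋆G : ∀ x m n → (X ⋆ G x m) n ≈ ⟦ suc m ⟧ * G x (suc m) n
  X⋆G x m zero = trans (zeroˡ (G x m 0)) (sym (trans (*-congˡ (G-suc-zero x m)) (zeroʳ ⟦ suc m ⟧)))
  X⋆G x zero (suc n) = begin
    (X ⋆ G x 0) (suc n)
      ≈⟨ X⋆-suc n (G x 0) ⟩
    ((X ⋆ G x 0) n + G x 0 n) + (X ⋆ D (G x 0)) n
      ≈⟨ +-congˡ (trans (⋆-congˡ n (G-zero-suc x)) (⋆-*ʳ n x X (G x 0))) ⟩
    ((X ⋆ G x 0) n + G x 0 n) + x * (X ⋆ G x 0) n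
      ≈⟨ +-cong (+-congʳ ih) (*-congˡ ih) ⟩
    (G x 1 n + G x 0 n) + x * G x 1 n
      ≈⟨ solve 3 (λ x g h → (g :+ h) :+ x :* g := con 1 :* ((x :+ con 1) :* g :+ h)) refl x (G x 1 n) (G x 0 n) ⟩
    1# * ((x + 1#) * G x 1 n + G x 0 n)
      ≈⟨ *-cong ⟦1⟧≈1 (+-congʳ (*-congʳ (+-congˡ ⟦1⟧≈1))) ⟨
    ⟦ 1 ⟧ * ((x + ⟦ 1 ⟧) * G x 1 n + G x 0 n)
      ≈⟨ *-congˡ (G-suc-suc x 0 n) ⟨
    ⟦ 1 ⟧ * G x 1 (suc n) ∎
    where
    ih : (X ⋆ G x 0) n ≈ G x 1 n
    ih = trans (X⋆G x zero n) (trans (*-congʳ ⟦1⟧≈1) (*-identityˡ (G x 1 n)))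
  X⋆G x (suc m) (suc n) = begin
    (X ⋆ G x (suc m)) (suc n)
      ≈⟨ X⋆-suc n (G x (suc m)) ⟩
    ((X ⋆ G x (suc m)) n + g) + (X ⋆ D (G x (suc m))) n
      ≈⟨ +-congˡ (⋆-congˡ n (G-suc-suc x m)) ⟩
    ((X ⋆ G x (suc m)) n + g) + (X ⋆ (λ i → (x + k) * G x (suc m) i + G x m i)) n
      ≈⟨ +-congˡ (⋆-distribˡ-+ n X (λ i → (x + k) * G x (suc m) i) (G x m)) ⟩
    ((X ⋆ G x (suc m)) n + g) + ((X ⋆ (λ i → (x + k) * G x (suc m) i)) n + (X ⋆ G x m) n)
      ≈⟨ +-congˡ (+-congʳ (⋆-*ʳ n (x + k) X (G x (suc m)))) ⟩
    ((X ⋆ G x (suc m)) n + g) + ((x + k) * (X ⋆ G x (suc m)) n + (X ⋆ G x m) n)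
      ≈⟨ +-cong (+-congʳ ih) (+-cong (*-congˡ ih) (X⋆G x m n)) ⟩
    ((1# + k) * h + g) + ((x + k) * ((1# + k) * h) + k * g)
      ≈⟨ solve 4 (λ x k g h → ((con 1 :+ k) :* h :+ g) :+ ((x :+ k) :* ((con 1 :+ k) :* h) :+ k :* g)
                              := (con 1 :+ k) :* ((x :+ (con 1 :+ k)) :* h :+ g)) refl x k g h ⟩
    (1# + k) * ((x + (1# + k)) * h + g)
      ≈⟨ *-cong (⟦suc⟧ (suc m)) (+-congʳ (*-congʳ (+-congˡ (⟦suc⟧ (suc m))))) ⟨
    ⟦ suc (suc m) ⟧ * ((x + ⟦ suc (suc m) ⟧) * h + g)
      ≈⟨ *-congˡ (G-suc-suc x (suc m) n) ⟨
    ⟦ suc (suc m) ⟧ * G x (suc (suc m)) (suc n) ∎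
    where
    k g h : A
    k = ⟦ suc m ⟧
    g = G x (suc m) n
    h = G x (suc (suc m)) n
    ih : (X ⋆ G x (suc m)) n ≈ (1# + k) * h
    ih = trans (X⋆G x (suc m) n) (*-congʳ (⟦suc⟧ (suc m)))

  -- The coefficientwise form of e^{xt} (1 + (e^t - 1))^z = e^{(x+z)t}.
  ∑-falling-G : ∀ x z (F : ℕ → A) → F 0 ≈ 1# → (∀ m → F (suc m) ≈ F m * (z + - ⟦ m ⟧)) →
                ∀ n → ∑< (suc n) (λ m → F m * G x m n) ≈ (x + z) ^ n
  ∑-falling-G x z F F-zero F-suc zero = begin
    F 0 * G x 0 0 + 0#   ≈⟨ +-identityʳ (F 0 * G x 0 0) ⟩
    F 0 * G x 0 0        ≈⟨ *-cong F-zero (G-zero-zero x) ⟩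
    1# * 1#              ≈⟨ *-identityˡ 1# ⟩
    1#                   ≈⟨ pow-zero (x + z) ⟨
    (x + z) ^ 0          ∎
  ∑-falling-G x z F F-zero F-suc (suc n) = begin
    F 0 * G x 0 (suc n) + ∑< (suc n) (λ m → F (suc m) * G x (suc m) (suc n))
      ≈⟨ +-cong u₀ (∑<-cong (suc n) (λ m _ → trans (*-congˡ (G-suc-suc x m n)) (distribute m))) ⟩
    u 0 + ∑< (suc n) (λ m → u (suc m) + v m)
      ≈⟨ +-congˡ (∑<-+ (suc n) (u ∘ suc) v) ⟩
    u 0 + (∑< (suc n) (u ∘ suc) + ∑< (suc n) v)
      ≈⟨ +-assoc (u 0) (∑< (suc n) (u ∘ suc)) (∑< (suc n) v) ⟨
    ∑< (suc (suc n)) u + ∑< (suc n) v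
      ≈⟨ +-congʳ (∑<-truncate (ℕ.n≤1+n (suc n)) u λ i n<i _ → trans (*-congˡ (trans (*-congˡ (G-vanish x n<i)) (zeroʳ _))) (zeroʳ _)) ⟩
    ∑< (suc n) u + ∑< (suc n) v
      ≈⟨ ∑<-+ (suc n) u v ⟨
    ∑< (suc n) (λ m → u m + v m)
      ≈⟨ ∑<-cong (suc n) (λ m _ → u+v m) ⟩
    ∑< (suc n) (λ m → (x + z) * (F m * G x m n))
      ≈⟨ ∑<-*ˡ (suc n) (x + z) (λ m → F m * G x m n) ⟩
    (x + z) * ∑< (suc n) (λ m → F m * G x m n)
      ≈⟨ *-congˡ (∑-falling-G x z F F-zero F-suc n) ⟩
    (x + z) * (x + z) ^ n
      ≈⟨ pow-suc (x + z) n ⟨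
    (x + z) ^ suc n ∎
    where
    u v : ℕ → A
    u m = F m * ((x + ⟦ m ⟧) * G x m n)
    v m = F (suc m) * G x m n
    u₀ : F 0 * G x 0 (suc n) ≈ u 0
    u₀ = *-congˡ (trans (G-zero-suc x n) (*-congʳ (sym (trans (+-congˡ ⟦0⟧≈0) (+-identityʳ x)))))
    distribute : ∀ m → F (suc m) * ((x + ⟦ suc m ⟧) * G x (suc m) n + G x m n) ≈ u (suc m) + v m
    distribute m = distribˡ (F (suc m)) ((x + ⟦ suc m ⟧) * G x (suc m) n) (G x m n)
    -- The x + m of the Stirling recurrence and the z - m of the falling factorial add up to x + z,
    -- which no longer depends on m and leaves the sum.
    u+v : ∀ m → u m + v m ≈ (x + z) * (F m * G x m n)
    u+v m = begin
      F m * ((x + k) * g) + F (suc m) * g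
        ≈⟨ +-congˡ (*-congʳ (F-suc m)) ⟩
      F m * ((x + k) * g) + F m * (z + - k) * g
        -- The solver works in semirings, so - k enters as an independent atom and is cancelled
        -- against k afterwards.
        ≈⟨ solve 6 (λ x z k k⁻ f g → f :* ((x :+ k) :* g) :+ f :* (z :+ k⁻) :* g
                                     := ((x :+ z) :+ (k :+ k⁻)) :* (f :* g)) refl x z k (- k) (F m) g ⟩
      ((x + z) + (k + - k)) * (F m * g)
        ≈⟨ *-congʳ (trans (+-congˡ (-‿inverseʳ k)) (+-identityʳ (x + z))) ⟩
      (x + z) * (F m * g) ∎
      where
      k = ⟦ m ⟧
      g = G x m n

  stirling₂-vanish : ∀ {n m} → n ℕ.< m → stirling₂ n m ≡ 0
  stirling₂-vanish {zero}  {suc m} _         = ≡.refl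
  stirling₂-vanish {suc n} {suc m} (s≤s n<m)
    rewrite stirling₂-vanish (ℕ.m<n⇒m<1+n n<m) | stirling₂-vanish n<m | ℕ.*-zeroʳ m = ≡.refl

  -- The binomial form of `G` runs up to i = n, but its terms with i > n - m contain a Stirling
  -- number whose upper index n - i is below m, hence vanish.
  genStirling₂≈G : ∀ x m n →
    ∑< (suc (n ∸ m)) (λ i → ⟦ n C i ⟧ * ⟦ stirling₂ (n ∸ i) m ⟧ * x ^ i) ≈ G x m n
  genStirling₂≈G x m n = begin
    ∑< (suc (n ∸ m)) (λ i → ⟦ n C i ⟧ * S m (n ∸ i) * x ^ i)
      ≈⟨ ∑<-truncate (s≤s (ℕ.m∸n≤m n m)) (λ i → ⟦ n C i ⟧ * S m (n ∸ i) * x ^ i) vanish ⟨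
    ∑< (suc n) (λ i → ⟦ n C i ⟧ * S m (n ∸ i) * x ^ i)
      ≈⟨ ∑<-cong (suc n) (λ i _ → solve 3 (λ a b c → a :* b :* c := a :* (c :* b)) refl ⟦ n C i ⟧ (S m (n ∸ i)) (x ^ i)) ⟩
    ∑< (suc n) (λ i → ⟦ n C i ⟧ * (x ^ i * S m (n ∸ i)))
      ≈⟨ ⋆-binomial n (x ^_) (S m) ⟩
    G x m n ∎
    where
    n∸i<m : ∀ i → suc (n ∸ m) ℕ.≤ i → i ℕ.≤ n → n ∸ i ℕ.< m
    n∸i<m i n∸m<i i≤n = ℕ.≰⇒> λ m≤n∸i → ℕ.<⇒≱ n∸m<i
      (ℕ.≤-trans (ℕ.≤-reflexive (≡.sym (ℕ.m∸[m∸n]≡n i≤n))) (ℕ.∸-monoʳ-≤ n m≤n∸i))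
    vanish : ∀ i → suc (n ∸ m) ℕ.≤ i → i ℕ.< suc n → ⟦ n C i ⟧ * S m (n ∸ i) * x ^ i ≈ 0#
    vanish i n∸m<i i<1+n = trans (*-congʳ (trans (*-congˡ (trans
      (reflexive (≡.cong ⟦_⟧ (stirling₂-vanish (n∸i<m i n∸m<i (ℕ.≤-pred i<1+n))))) ⟦0⟧≈0)) (zeroʳ _))) (zeroˡ _)

  -- Strong induction on the coefficients of the difference `u`: once those below i vanish,
  -- coefficient i + 1 of (e^t - 1) u is (i + 1) times the i-th coefficient of `u`, and the factor i
  -- + 1 can be cancelled.
  X-injective : (f g : ℕ → A) → (∀ n a → eq (mul ⟦ suc n ⟧ a) nought → eq a nought) →
                (∀ n → (X ⋆ f) n ≈ (X ⋆ g) n) → ∀ n → f n ≈ g n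
  X-injective f g torsionFree Xf≈Xg n = x∙y⁻¹≈ε⇒x≈y (f n) (g n)
    (trans (+-congˡ (sym (-1*x≈-x (g n)))) (lower (suc n) n ℕ.≤-refl))
    where
    u : ℕ → A
    u i = f i + - 1# * g i
    X⋆u≈0 : ∀ i → (X ⋆ u) i ≈ 0#
    X⋆u≈0 i = begin
      (X ⋆ u) i                                  ≈⟨ ⋆-distribˡ-+ i X f (λ j → - 1# * g j) ⟩
      (X ⋆ f) i + (X ⋆ (λ j → - 1# * g j)) i     ≈⟨ +-congˡ (⋆-*ʳ i (- 1#) X g) ⟩
      (X ⋆ f) i + - 1# * (X ⋆ g) i               ≈⟨ +-cong (Xf≈Xg i) (-1*x≈-x ((X ⋆ g) i)) ⟩
      (X ⋆ g) i + - (X ⋆ g) i                    ≈⟨ -‿inverseʳ ((X ⋆ g) i) ⟩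
      0#                                         ∎
    lower : ∀ k i → i ℕ.< k → u i ≈ 0#
    lower (suc k) i i<1+k with ℕ.m<1+n⇒m<n∨m≡n i<1+k
    ... | inj₁ i<k    = lower k i i<k
    ... | inj₂ ≡.refl = torsionFree i (u i)
      (trans (sym (X⋆-lowest i u (lower i))) (X⋆u≈0 (suc i)))

  -- Division by positive integers and the generating function identities

  module Division
    (inv : ℕ → A)
    (inverse⁺ : ∀ n → eq (mul ⟦ suc n ⟧ (inv (suc n))) one)
    where

    inverse : ∀ n .{{_ : NonZero n}} → ⟦ n ⟧ * inv n ≈ 1#
    inverse (suc n) = inverse⁺ n

    *-cancel-inv : ∀ n .{{_ : NonZero n}} a → inv n * (⟦ n ⟧ * a) ≈ a
    *-cancel-inv n a = begin
      inv n * (⟦ n ⟧ * a)   ≈⟨ solve 3 (λ i k a → i :* (k :* a) := (k :* i) :* a) refl (inv n) ⟦ n ⟧ a ⟩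
      (⟦ n ⟧ * inv n) * a   ≈⟨ *-congʳ (inverse n) ⟩
      1# * a                ≈⟨ *-identityˡ a ⟩
      a                     ∎

    torsionFree : ∀ n a → ⟦ suc n ⟧ * a ≈ 0# → a ≈ 0#
    torsionFree n a na≈0 = trans (sym (*-cancel-inv (suc n) a)) (trans (*-congˡ na≈0) (zeroʳ (inv (suc n))))

    inv1≈1 : inv 1 ≈ 1#
    inv1≈1 = trans (sym (*-identityˡ (inv 1))) (trans (*-congʳ (sym ⟦1⟧≈1)) (inverse 1))

    φ : ℕ → A
    φ n = inv (n !)

    ⟦!⟧*φ : ∀ n → ⟦ n ! ⟧ * φ n ≈ 1#
    ⟦!⟧*φ n = inverse (n !) {{n ℕ.!≢0}}

    φ*φ : ∀ n i → i ℕ.≤ n → φ i * φ (n ∸ i) ≈ ⟦ n C i ⟧ * φ n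
    φ*φ n i i≤n = begin
      φ i * φ (n ∸ i)
        ≈⟨ *-identityʳ (φ i * φ (n ∸ i)) ⟨
      φ i * φ (n ∸ i) * 1#
        ≈⟨ *-congˡ (⟦!⟧*φ n) ⟨
      φ i * φ (n ∸ i) * (⟦ n ! ⟧ * φ n)
        ≈⟨ *-congˡ (*-congʳ (trans (reflexive (≡.cong ⟦_⟧ (≡.sym (nCk*[k!*[n∸k]!]≡n! i≤n))))
             (trans (⟦*⟧ (n C i) (i ! ℕ.* (n ∸ i) !)) (*-congˡ (⟦*⟧ (i !) ((n ∸ i) !)))))) ⟩
      φ i * φ (n ∸ i) * ((⟦ n C i ⟧ * (⟦ i ! ⟧ * ⟦ (n ∸ i) ! ⟧)) * φ n)
        ≈⟨ solve 6 (λ p q c a b r → p :* q :* ((c :* (a :* b)) :* r) := (a :* p) :* (b :* q) :* (c :* r)) refl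
             (φ i) (φ (n ∸ i)) ⟦ n C i ⟧ ⟦ i ! ⟧ ⟦ (n ∸ i) ! ⟧ (φ n) ⟩
      (⟦ i ! ⟧ * φ i) * (⟦ (n ∸ i) ! ⟧ * φ (n ∸ i)) * (⟦ n C i ⟧ * φ n)
        ≈⟨ *-congʳ (trans (*-cong (⟦!⟧*φ i) (⟦!⟧*φ (n ∸ i))) (*-identityˡ 1#)) ⟩
      1# * (⟦ n C i ⟧ * φ n)
        ≈⟨ *-identityˡ (⟦ n C i ⟧ * φ n) ⟩
      ⟦ n C i ⟧ * φ n ∎

    -- Translates the Cauchy product of ordinary coefficients into `_⋆_`: 1/i! times 1/(n-i)! is the
    -- binomial coefficient divided by n!.
    egf-⋆ : ∀ n (f g : ℕ → A) →
            ∑< (suc n) (λ i → (f i * φ i) * (g (n ∸ i) * φ (n ∸ i))) ≈ φ n * (f ⋆ g) n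
    egf-⋆ n f g = begin
      ∑< (suc n) (λ i → (f i * φ i) * (g (n ∸ i) * φ (n ∸ i)))
        ≈⟨ ∑<-cong (suc n) (λ i i<1+n → regroup i (ℕ.≤-pred i<1+n)) ⟩
      ∑< (suc n) (λ i → φ n * (⟦ n C i ⟧ * (f i * g (n ∸ i))))
        ≈⟨ ∑<-*ˡ (suc n) (φ n) (λ i → ⟦ n C i ⟧ * (f i * g (n ∸ i))) ⟩
      φ n * ∑< (suc n) (λ i → ⟦ n C i ⟧ * (f i * g (n ∸ i)))
        ≈⟨ *-congˡ (⋆-binomial n f g) ⟩
      φ n * (f ⋆ g) n ∎
      where
      regroup : ∀ i → i ℕ.≤ n →
        (f i * φ i) * (g (n ∸ i) * φ (n ∸ i)) ≈ φ n * (⟦ n C i ⟧ * (f i * g (n ∸ i)))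
      regroup i i≤n = begin
        (f i * φ i) * (g (n ∸ i) * φ (n ∸ i))
          ≈⟨ solve 4 (λ a p b q → (a :* p) :* (b :* q) := (p :* q) :* (a :* b)) refl (f i) (φ i) (g (n ∸ i)) (φ (n ∸ i)) ⟩
        (φ i * φ (n ∸ i)) * (f i * g (n ∸ i))
          ≈⟨ *-congʳ (φ*φ n i i≤n) ⟩
        (⟦ n C i ⟧ * φ n) * (f i * g (n ∸ i))
          ≈⟨ solve 3 (λ c p a → (c :* p) :* a := p :* (c :* a)) refl ⟦ n C i ⟧ (φ n) (f i * g (n ∸ i)) ⟩
        φ n * (⟦ n C i ⟧ * (f i * g (n ∸ i))) ∎

    φ-cancel : ∀ n {a b} → φ n * a ≈ φ n * b → a ≈ b
    φ-cancel n {a} {b} eq = begin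
      a                      ≈⟨ *-cancel-inv (n !) {{n ℕ.!≢0}} a ⟨
      φ n * (⟦ n ! ⟧ * a)    ≈⟨ swap a ⟩
      ⟦ n ! ⟧ * (φ n * a)    ≈⟨ *-congˡ eq ⟩
      ⟦ n ! ⟧ * (φ n * b)    ≈⟨ swap b ⟨
      φ n * (⟦ n ! ⟧ * b)    ≈⟨ *-cancel-inv (n !) {{n ℕ.!≢0}} b ⟩
      b                      ∎
      where
      swap : ∀ a → φ n * (⟦ n ! ⟧ * a) ≈ ⟦ n ! ⟧ * (φ n * a)
      swap = solve 3 (λ p k a → p :* (k :* a) := k :* (p :* a)) refl (φ n) ⟦ n ! ⟧

    1^n≈1 : ∀ n → 1# ^ n ≈ 1#
    1^n≈1 zero    = pow-zero 1#
    1^n≈1 (suc n) = trans (pow-suc 1# n) (trans (*-identityˡ (1# ^ n)) (1^n≈1 n))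

    -- o and t stand for the power series 1 and t.
    bernoulli⇒T-pow≈X⋆ : ∀ x (o t b : ℕ → A) →
      eq (o 0) one → (∀ n → eq (o (suc n)) nought) →
      eq (t 0) nought → eq (t 1) one → (∀ n → eq (t (suc (suc n))) nought) →
      (∀ n → eq (bigop add nought (suc n) (λ i → mul (t i) (mul (power mul one x (n ∸ i)) (inv ((n ∸ i) !)))))
                (bigop add nought (suc n) (λ i → mul (add (mul (power mul one one i) (inv (i !))) (neg (o i)))
                                                     (mul (b (n ∸ i)) (inv ((n ∸ i) !)))))) →
      ∀ n → T (x ^_) n ≈ (X ⋆ b) n
    bernoulli⇒T-pow≈X⋆ x o t b o-zero o-suc t-zero t-one t-suc hyp n = φ-cancel n (begin
      φ n * T (x ^_) n
        ≈⟨ *-congˡ (T-cong n (λ i → sym (⋆-identityʳ i (x ^_)))) ⟩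
      φ n * T ((x ^_) ⋆ δ) n
        ≈⟨ *-congˡ (⋆-T n (x ^_) δ) ⟨
      φ n * ((x ^_) ⋆ T δ) n
        ≈⟨ *-congˡ (⋆-comm n (x ^_) (T δ)) ⟩
      φ n * (T δ ⋆ (x ^_)) n
        ≈⟨ egf-⋆ n (T δ) (x ^_) ⟨
      ∑< (suc n) (λ i → (T δ i * φ i) * (x ^ (n ∸ i) * φ (n ∸ i)))
        ≈⟨ ∑<-cong (suc n) (λ i _ → *-congʳ {x ^ (n ∸ i) * φ (n ∸ i)} (Tδ i)) ⟩
      ∑< (suc n) (λ i → t i * (x ^ (n ∸ i) * φ (n ∸ i)))
        ≈⟨ hyp n ⟩
      ∑< (suc n) (λ i → (1# ^ i * φ i + - o i) * (b (n ∸ i) * φ (n ∸ i)))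
        ≈⟨ ∑<-cong (suc n) (λ i _ → *-congʳ {b (n ∸ i) * φ (n ∸ i)} (exp-1 i)) ⟩
      ∑< (suc n) (λ i → (X i * φ i) * (b (n ∸ i) * φ (n ∸ i)))
        ≈⟨ egf-⋆ n X b ⟩
      φ n * (X ⋆ b) n ∎)
      where
      Tδ : ∀ i → T δ i * φ i ≈ t i
      Tδ zero          = trans (zeroˡ (φ 0)) (sym t-zero)
      Tδ (suc zero)    = trans (*-cong (*-identityʳ ⟦ 1 ⟧) inv1≈1)
        (trans (trans (*-identityʳ ⟦ 1 ⟧) ⟦1⟧≈1) (sym t-one))
      Tδ (suc (suc i)) = trans (*-congʳ (zeroʳ ⟦ suc (suc i) ⟧)) (trans (zeroˡ (φ (suc (suc i)))) (sym (t-suc i)))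
      exp-1 : ∀ i → 1# ^ i * φ i + - o i ≈ X i * φ i
      exp-1 zero    = begin
        1# ^ 0 * φ 0 + - o 0   ≈⟨ +-cong (*-cong (pow-zero 1#) inv1≈1) (-‿cong o-zero) ⟩
        1# * 1# + - 1#         ≈⟨ +-congʳ (*-identityˡ 1#) ⟩
        1# + - 1#              ≈⟨ -‿inverseʳ 1# ⟩
        0#                     ≈⟨ zeroˡ (φ 0) ⟨
        0# * φ 0               ∎
      exp-1 (suc i) = begin
        1# ^ suc i * φ (suc i) + - o (suc i)   ≈⟨ +-cong (*-congʳ (1^n≈1 (suc i))) (-‿cong (o-suc i)) ⟩
        1# * φ (suc i) + - 0#                  ≈⟨ +-congˡ -0#≈0# ⟩
        1# * φ (suc i) + 0#                    ≈⟨ +-identityʳ (1# * φ (suc i)) ⟩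
        1# * φ (suc i)                         ∎

    cauchySum : A → (ℕ → A) → ℕ → A
    cauchySum x a n = ∑< (suc n) (λ m → (a (suc m) * inv (suc m)) * G x m n)

    X⋆cauchySum : ∀ x (a ν : ℕ → A) → a 0 ≈ 1# →
      (∀ n → ∑< (suc n) (λ m → a m * G x m n) ≈ ν n) →
      ∀ n → (X ⋆ cauchySum x a) n + x ^ n ≈ ν n
    X⋆cauchySum x a ν a₀≈1 expansion n = begin
      (X ⋆ cauchySum x a) n + x ^ n
        -- The upper limit of the sum varies with the coefficient i. Raising it to the common value
        -- n adds only zeros, as `G x m i` vanishes for m > i, and lets the product pass through the
        -- sum.
        ≈⟨ +-congʳ (⋆-cong-≤ n (λ _ _ → refl) (λ i i≤n → sym (∑<-truncate (s≤s i≤n) (λ m → b m * G x m i)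
             (λ m i<m _ → trans (*-congˡ (G-vanish x i<m)) (zeroʳ (b m)))))) ⟩
      (X ⋆ (λ i → ∑< (suc n) (λ m → b m * G x m i))) n + x ^ n
        ≈⟨ +-congʳ (⋆-∑< (suc n) n X (λ m i → b m * G x m i)) ⟩
      ∑< (suc n) (λ m → (X ⋆ (λ i → b m * G x m i)) n) + x ^ n
        -- Multiplication by e^t - 1 has shifted m to m + 1; the summand x^n supplies the missing
        -- term m = 0 of the expansion.
        ≈⟨ +-cong (∑<-cong (suc n) (λ m _ → step m)) (sym (trans (*-cong a₀≈1 (G-zero x n)) (*-identityˡ (x ^ n)))) ⟩
      ∑< (suc n) (λ m → a (suc m) * G x (suc m) n) + a 0 * G x 0 n
        ≈⟨ +-comm _ (a 0 * G x 0 n) ⟩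
      ∑< (suc (suc n)) (λ m → a m * G x m n)
        ≈⟨ ∑<-truncate (ℕ.n≤1+n (suc n)) (λ m → a m * G x m n) (λ m n<m _ → trans (*-congˡ (G-vanish x n<m)) (zeroʳ (a m))) ⟩
      ∑< (suc n) (λ m → a m * G x m n)
        ≈⟨ expansion n ⟩
      ν n ∎
      where
      b : ℕ → A
      b m = a (suc m) * inv (suc m)
      step : ∀ m → (X ⋆ (λ i → b m * G x m i)) n ≈ a (suc m) * G x (suc m) n
      step m = begin
        (X ⋆ (λ i → b m * G x m i)) n
          ≈⟨ ⋆-*ʳ n (b m) X (G x m) ⟩
        a (suc m) * inv (suc m) * (X ⋆ G x m) n
          ≈⟨ *-congˡ (X⋆G x m n) ⟩
        a (suc m) * inv (suc m) * (⟦ suc m ⟧ * G x (suc m) n)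
          ≈⟨ solve 4 (λ a i k g → a :* i :* (k :* g) := a :* (i :* (k :* g))) refl
               (a (suc m)) (inv (suc m)) ⟦ suc m ⟧ (G x (suc m) n) ⟩
        a (suc m) * (inv (suc m) * (⟦ suc m ⟧ * G x (suc m) n))
          ≈⟨ *-congˡ (*-cancel-inv (suc m) (G x (suc m) n)) ⟩
        a (suc m) * G x (suc m) n ∎

    T-cauchySum : ∀ x (a ν κ b : ℕ → A) → a 0 ≈ 1# →
      (∀ n → ∑< (suc n) (λ m → a m * G x m n) ≈ ν n) →
      (∀ n → T ν n ≈ (X ⋆ κ) n) → (∀ n → T (x ^_) n ≈ (X ⋆ b) n) →
      ∀ n → κ n ≈ T (cauchySum x a) n + b n
    T-cauchySum x a ν κ b a₀≈1 expansion Tν Tx = X-injective κ (λ n → T P n + b n) torsionFree λ n → begin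
      (X ⋆ κ) n                         ≈⟨ Tν n ⟨
      T ν n                             ≈⟨ T-cong n (X⋆cauchySum x a ν a₀≈1 expansion) ⟨
      T (λ i → (X ⋆ P) i + x ^ i) n     ≈⟨ T-+ n (X ⋆ P) (x ^_) ⟩
      T (X ⋆ P) n + T (x ^_) n          ≈⟨ +-cong (sym (⋆-T n X P)) (Tx n) ⟩
      (X ⋆ T P) n + (X ⋆ b) n           ≈⟨ ⋆-distribˡ-+ n X (T P) b ⟨
      (X ⋆ (λ i → T P i + b i)) n       ∎
      where
      P : ℕ → A
      P = cauchySum x a

    cauchySum-suc : ∀ x (a ν κ b : ℕ → A) → a 0 ≈ 1# →
      (∀ n → ∑< (suc n) (λ m → a m * G x m n) ≈ ν n) →
      (∀ n → T ν n ≈ (X ⋆ κ) n) → (∀ n → T (x ^_) n ≈ (X ⋆ b) n) →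
      ∀ n → (κ (suc n) + - b (suc n)) * inv (suc n) ≈ cauchySum x a n
    cauchySum-suc x a ν κ b a₀≈1 expansion Tν Tx n = begin
      (κ (suc n) + - b (suc n)) * inv (suc n)
        ≈⟨ *-congʳ (+-congʳ (T-cauchySum x a ν κ b a₀≈1 expansion Tν Tx (suc n))) ⟩
      ((⟦ suc n ⟧ * P + b (suc n)) + - b (suc n)) * inv (suc n)
        ≈⟨ *-congʳ (trans (+-assoc (⟦ suc n ⟧ * P) (b (suc n)) (- b (suc n)))
             (trans (+-congˡ (-‿inverseʳ (b (suc n)))) (+-identityʳ (⟦ suc n ⟧ * P)))) ⟩
      (⟦ suc n ⟧ * P) * inv (suc n)
        ≈⟨ *-comm (⟦ suc n ⟧ * P) (inv (suc n)) ⟩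
      inv (suc n) * (⟦ suc n ⟧ * P)
        ≈⟨ *-cancel-inv (suc n) P ⟩
      P ∎
      where P = cauchySum x a n

    -- The numbers 1/(n+1) are the Taylor coefficients of (e^t - 1)/t, which gives κ = 1.
    T-inv≈X⋆δ : ∀ n → T (λ i → inv (suc i)) n ≈ (X ⋆ δ) n
    T-inv≈X⋆δ zero    = sym (⋆-identityʳ 0 X)
    T-inv≈X⋆δ (suc n) = trans (inverse (suc n)) (sym (⋆-identityʳ (suc n) X))

    X⋆pow[-1] : ∀ n → (X ⋆ ((- 1#) ^_)) (suc n) ≈ (- 1#) ^ n
    X⋆pow[-1] n = begin
      (X ⋆ s) (suc n)
        ≈⟨ X⋆-suc n s ⟩
      ((X ⋆ s) n + s n) + (X ⋆ D s) n
        ≈⟨ +-congˡ (trans (⋆-congˡ n (pow-suc (- 1#))) (⋆-*ʳ n (- 1#) X s)) ⟩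
      ((X ⋆ s) n + s n) + - 1# * (X ⋆ s) n
        ≈⟨ +-cong (+-comm ((X ⋆ s) n) (s n)) (-1*x≈-x ((X ⋆ s) n)) ⟩
      (s n + (X ⋆ s) n) + - (X ⋆ s) n
        ≈⟨ +-assoc (s n) ((X ⋆ s) n) (- (X ⋆ s) n) ⟩
      s n + ((X ⋆ s) n + - (X ⋆ s) n)
        ≈⟨ +-congˡ (-‿inverseʳ ((X ⋆ s) n)) ⟩
      s n + 0#
        ≈⟨ +-identityʳ (s n) ⟩
      s n ∎
      where
      s : ℕ → A
      s = (- 1#) ^_

    T-inv≈X⋆pow[-1] : ∀ n → T (λ i → (- 1#) ^ i * inv (suc i)) n ≈ (X ⋆ ((- 1#) ^_)) n
    T-inv≈X⋆pow[-1] zero    = sym (zeroˡ ((- 1#) ^ 0))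
    T-inv≈X⋆pow[-1] (suc n) = begin
      ⟦ suc n ⟧ * ((- 1#) ^ n * inv (suc n))   ≈⟨ solve 3 (λ k s i → k :* (s :* i) := (k :* i) :* s) refl ⟦ suc n ⟧ ((- 1#) ^ n) (inv (suc n)) ⟩
      (⟦ suc n ⟧ * inv (suc n)) * (- 1#) ^ n   ≈⟨ *-congʳ (inverse (suc n)) ⟩
      1# * (- 1#) ^ n                          ≈⟨ *-identityˡ ((- 1#) ^ n) ⟩
      (- 1#) ^ n                               ≈⟨ X⋆pow[-1] n ⟨
      (X ⋆ ((- 1#) ^_)) (suc n)                ∎

    -- The averaging relation and the Cauchy numbers

    module Mean
      (Mean : (A → A) → A → Set)
      (Mean-cong : ∀ {f g I J} → (∀ t → eq (f t) (g t)) → eq I J → Mean f I → Mean g J)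
      (Mean-+ : ∀ {f g I J} → Mean f I → Mean g J → Mean (λ t → add (f t) (g t)) (add I J))
      (Mean-* : ∀ c {f I} → Mean f I → Mean (λ t → mul c (f t)) (mul c I))
      (Mean-unique : ∀ {f I J} → Mean f I → Mean f J → eq I J)
      (Mean-pow : ∀ k → Mean (λ t → power mul one t k) (inv (suc k)))
      (falling : A → ℕ → A)
      (falling-zero : ∀ z → eq (falling z 0) one)
      (falling-suc : ∀ z n → eq (falling z (suc n)) (mul (falling z n) (add z (neg ⟦ n ⟧))))
      (x : A)
      (gs : ℕ → ℕ → A)
      (gs-def : ∀ n m → eq (gs n m)
        (bigop add nought (suc (n ∸ m)) (λ i → mul (mul ⟦ n C i ⟧ ⟦ stirling₂ (n ∸ i) m ⟧) (power mul one x i))))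
      (o t b : ℕ → A)
      (o-zero : eq (o 0) one) (o-suc : ∀ n → eq (o (suc n)) nought)
      (t-zero : eq (t 0) nought) (t-one : eq (t 1) one) (t-suc : ∀ n → eq (t (suc (suc n))) nought)
      (bernoulli : ∀ n →
        eq (bigop add nought (suc n) (λ i → mul (t i) (mul (power mul one x (n ∸ i)) (inv ((n ∸ i) !)))))
           (bigop add nought (suc n) (λ i → mul (add (mul (power mul one one i) (inv (i !))) (neg (o i)))
                                                (mul (b (n ∸ i)) (inv ((n ∸ i) !))))))
      where

      b-def : ∀ n → T (x ^_) n ≈ (X ⋆ b) n
      b-def = bernoulli⇒T-pow≈X⋆ x o t b o-zero o-suc t-zero t-one t-suc bernoulli

      pow-cong : ∀ n {y z} → y ≈ z → y ^ n ≈ z ^ n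
      pow-cong zero    {y} {z} y≈z = trans (pow-zero y) (sym (pow-zero z))
      pow-cong (suc n) {y} {z} y≈z =
        trans (pow-suc y n) (trans (*-cong y≈z (pow-cong n y≈z)) (sym (pow-suc z n)))

      pow-neg : ∀ n y → (- y) ^ n ≈ (- 1#) ^ n * y ^ n
      pow-neg zero    y = trans (pow-zero (- y))
        (sym (trans (*-cong (pow-zero (- 1#)) (pow-zero y)) (*-identityˡ 1#)))
      pow-neg (suc n) y = begin
        (- y) ^ suc n                              ≈⟨ pow-suc (- y) n ⟩
        - y * (- y) ^ n                            ≈⟨ *-cong (sym (-1*x≈-x y)) (pow-neg n y) ⟩
        (- 1# * y) * ((- 1#) ^ n * y ^ n)
          ≈⟨ solve 4 (λ s y p q → (s :* y) :* (p :* q) := (s :* p) :* (y :* q)) refl (- 1#) y ((- 1#) ^ n) (y ^ n) ⟩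
        (- 1# * (- 1#) ^ n) * (y * y ^ n)          ≈⟨ *-cong (pow-suc (- 1#) n) (pow-suc y n) ⟨
        (- 1#) ^ suc n * y ^ suc n                 ∎

      Mean-∑< : ∀ k {f : ℕ → A → A} {I : ℕ → A} (c : ℕ → A) → (∀ m → Mean (f m) (I m)) →
                Mean (λ t → ∑< k (λ m → c m * f m t)) (∑< k (λ m → c m * I m))
      -- The zero function is averaged as 0 times the monomial t^0.
      Mean-∑< zero    c means = Mean-cong (λ t → zeroˡ (t ^ 0)) (zeroˡ (inv 1)) (Mean-* 0# (Mean-pow 0))
      Mean-∑< (suc k) c means = Mean-+ (Mean-* (c 0) (means 0)) (Mean-∑< k (c ∘ suc) (means ∘ suc))

      module _ (z : A → A) (I a ν : ℕ → A)
        (Mean-binom : ∀ m → Mean (λ t → mul (falling (z t) m) (φ m)) (I m))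
        (a-def : ∀ m → eq (a m) (mul ⟦ m ! ⟧ (I m)))
        (Mean-ν : ∀ n → Mean (λ t → (x + z t) ^ n) (ν n))
        where

        Mean-falling : ∀ m → Mean (λ t → falling (z t) m) (a m)
        Mean-falling m = Mean-cong cancel (sym (a-def m)) (Mean-* ⟦ m ! ⟧ (Mean-binom m))
          where
          cancel : ∀ t → ⟦ m ! ⟧ * (falling (z t) m * φ m) ≈ falling (z t) m
          cancel t = trans
            (solve 3 (λ k f p → k :* (f :* p) := (k :* p) :* f) refl ⟦ m ! ⟧ (falling (z t) m) (φ m))
            (trans (*-congʳ (⟦!⟧*φ m)) (*-identityˡ (falling (z t) m)))

        a-zero : a 0 ≈ 1#
        a-zero = trans (Mean-unique
          (Mean-cong (λ t → trans (falling-zero (z t)) (sym (pow-zero t))) refl (Mean-falling 0))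
          (Mean-pow 0)) inv1≈1

        -- Both sides are means of t ↦ (x + z t)^n: for each t, `∑-falling-G` expands this power in
        -- falling factorials of z t, and the `G x m n` are constants of the averaging.
        expansion : ∀ n → ∑< (suc n) (λ m → a m * G x m n) ≈ ν n
        expansion n = Mean-unique
          (Mean-cong
            (λ t → trans (∑<-cong (suc n) (λ m _ → *-comm (G x m n) (falling (z t) m)))
              (∑-falling-G x (z t) (falling (z t)) (falling-zero (z t)) (falling-suc (z t)) n))
            (∑<-cong (suc n) (λ m _ → *-comm (G x m n) (a m)))
            (Mean-∑< (suc n) (λ m → G x m n) Mean-falling))
          (Mean-ν n)

        cauchySum≈genStirling : ∀ (κ : ℕ → A) → (∀ n → T ν n ≈ (X ⋆ κ) n) → ∀ n →
          (κ (suc n) + - b (suc n)) * inv (suc n) ≈ ∑< (suc n) (λ m → (a (suc m) * inv (suc m)) * gs n m)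
        cauchySum≈genStirling κ Tν n = trans
          (cauchySum-suc x a ν κ b a-zero expansion Tν b-def n)
          (∑<-cong (suc n) (λ m _ → *-congˡ {a (suc m) * inv (suc m)} (sym (trans (gs-def n m) (genStirling₂≈G x m n)))))

      cauchy₁-bernoulli : (I a : ℕ → A) →
        (∀ m → Mean (λ t → mul (falling (add t (neg x)) m) (inv (m !))) (I m)) →
        (∀ m → eq (a m) (mul ⟦ m ! ⟧ (I m))) →
        ∀ n → eq (neg (mul (b (suc n)) (inv (suc n))))
                 (bigop add nought (suc n) (λ m → mul (mul (a (suc m)) (inv (suc m))) (gs n m)))
      cauchy₁-bernoulli I a Mean-binom a-def n = trans
        -- Here κ is `δ`, which is 0 at the positive index n + 1; the added 0 matches this value of
        -- κ.
        (trans (-‿distribˡ-* (b (suc n)) (inv (suc n))) (*-congʳ (sym (+-identityˡ (- b (suc n))))))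
        (cauchySum≈genStirling (λ t → t + - x) I a (λ n → inv (suc n)) Mean-binom a-def
          (λ n → Mean-cong (λ t → pow-cong n (sym (x+[t-x]≈t t))) refl (Mean-pow n)) δ T-inv≈X⋆δ n)
        where
        x+[t-x]≈t : ∀ t → x + (t + - x) ≈ t
        x+[t-x]≈t t = trans (solve 3 (λ x t y → x :+ (t :+ y) := t :+ (x :+ y)) refl x t (- x))
          (trans (+-congˡ (-‿inverseʳ x)) (+-identityʳ t))

      cauchy₂-bernoulli : (I a : ℕ → A) →
        (∀ m → Mean (λ t → mul (falling (add (neg x) (neg t)) m) (inv (m !))) (I m)) →
        (∀ m → eq (a m) (mul ⟦ m ! ⟧ (I m))) →
        ∀ n → eq (mul (add (power mul one (neg one) (suc n)) (neg (b (suc n)))) (inv (suc n)))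
                 (bigop add nought (suc n) (λ m → mul (mul (a (suc m)) (inv (suc m))) (gs n m)))
      cauchy₂-bernoulli I a Mean-binom a-def =
        cauchySum≈genStirling (λ t → - x + - t) I a (λ n → (- 1#) ^ n * inv (suc n)) Mean-binom a-def
          (λ n → Mean-cong (λ t → trans (sym (pow-neg n t)) (pow-cong n (sym (x+[-x-t]≈-t t)))) refl
            (Mean-* ((- 1#) ^ n) (Mean-pow n)))
          ((- 1#) ^_) T-inv≈X⋆pow[-1]
        where
        x+[-x-t]≈-t : ∀ t → x + (- x + - t) ≈ - t
        x+[-x-t]≈-t t = trans (sym (+-assoc x (- x) (- t)))
          (trans (+-congʳ (-‿inverseʳ x)) (+-identityˡ (- t)))

-- Power sums and rational estimates

open +-*-Solver using (solve; _:=_; _:+_; _:*_; :-_; _:-_; con)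

∑ℕ-last : ∀ n s → ∑ℕ (suc n) s ≡ ∑ℕ n s ℕ.+ s n
∑ℕ-last zero    s = ℕ.+-identityʳ (s 0)
∑ℕ-last (suc n) s = ≡.trans (cong (s 0 ℕ.+_) (∑ℕ-last n (s ∘ suc)))
  (≡.sym (ℕ.+-assoc (s 0) (∑ℕ n (s ∘ suc)) (s (suc n))))

module _ where
  open import Data.Nat.Base
  open ℕ.≤-Reasoning

  -- With the next lemma, the discrete mean value estimate for t^{k+1} on [n, n+1]: the increment
  -- lies between (k+1) n^k and (k+1) (n+1)^k. Summing these increments bounds the power sums.
  n^[1+k]+[1+k]n^k≤[1+n]^[1+k] : ∀ n k → n ^ suc k + suc k * n ^ k ≤ suc n ^ suc k
  n^[1+k]+[1+k]n^k≤[1+n]^[1+k] n zero    = ℕ.≤-reflexive (base n)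
    where
    base : ∀ n → n * 1 + 1 * 1 ≡ suc n * 1
    base = solve-∀
  n^[1+k]+[1+k]n^k≤[1+n]^[1+k] n (suc k) = begin
    n ^ suc (suc k) + suc (suc k) * n ^ suc k            ≡⟨ regroup n k (n ^ k) ⟩
    n * (n ^ suc k + suc k * n ^ k) + n ^ suc k          ≤⟨ ℕ.+-mono-≤ (ℕ.*-monoʳ-≤ n (n^[1+k]+[1+k]n^k≤[1+n]^[1+k] n k))
                                                             (ℕ.^-monoˡ-≤ (suc k) (ℕ.n≤1+n n)) ⟩
    n * suc n ^ suc k + suc n ^ suc k                    ≡⟨ ℕ.+-comm (n * suc n ^ suc k) (suc n ^ suc k) ⟩
    suc n ^ suc (suc k)                                  ∎
    where
    regroup : ∀ n k p → n * (n * p) + suc (suc k) * (n * p) ≡ n * (n * p + suc k * p) + n * p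
    regroup = solve-∀

  [1+n]^[1+k]≤n^[1+k]+[1+k][1+n]^k : ∀ n k → suc n ^ suc k ≤ n ^ suc k + suc k * suc n ^ k
  [1+n]^[1+k]≤n^[1+k]+[1+k][1+n]^k n zero    = ℕ.≤-reflexive (base n)
    where
    base : ∀ n → suc n * 1 ≡ n * 1 + 1 * 1
    base = solve-∀
  [1+n]^[1+k]≤n^[1+k]+[1+k][1+n]^k n (suc k) = begin
    suc n * suc n ^ suc k                                  ≤⟨ ℕ.*-monoʳ-≤ (suc n) ([1+n]^[1+k]≤n^[1+k]+[1+k][1+n]^k n k) ⟩
    suc n * (n ^ suc k + suc k * suc n ^ k)                ≡⟨ regroup₁ n k (n ^ suc k) (suc n ^ k) ⟩
    n ^ suc (suc k) + (n ^ suc k + suc k * suc n ^ suc k)  ≤⟨ ℕ.+-monoʳ-≤ (n ^ suc (suc k))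
                                                               (ℕ.+-monoˡ-≤ (suc k * suc n ^ suc k) (ℕ.^-monoˡ-≤ (suc k) (ℕ.n≤1+n n))) ⟩
    n ^ suc (suc k) + suc (suc k) * suc n ^ suc k          ∎
    where
    regroup₁ : ∀ n k p q → suc n * (p + suc k * q) ≡ n * p + (p + suc k * (suc n * q))
    regroup₁ = solve-∀

  [1+k]∑i^k≤n^[1+k] : ∀ k n → suc k * ∑ℕ n (_^ k) ≤ n ^ suc k
  [1+k]∑i^k≤n^[1+k] k zero    = ℕ.≤-reflexive (ℕ.*-zeroʳ (suc k))
  [1+k]∑i^k≤n^[1+k] k (suc n) = begin
    suc k * ∑ℕ (suc n) (_^ k)               ≡⟨ cong (suc k *_) (∑ℕ-last n (_^ k)) ⟩
    suc k * (∑ℕ n (_^ k) + n ^ k)           ≡⟨ ℕ.*-distribˡ-+ (suc k) (∑ℕ n (_^ k)) (n ^ k) ⟩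
    suc k * ∑ℕ n (_^ k) + suc k * n ^ k     ≤⟨ ℕ.+-monoˡ-≤ (suc k * n ^ k) ([1+k]∑i^k≤n^[1+k] k n) ⟩
    n ^ suc k + suc k * n ^ k               ≤⟨ n^[1+k]+[1+k]n^k≤[1+n]^[1+k] n k ⟩
    suc n ^ suc k                           ∎

  -- The extra n^k closes the sum at its upper end: `∑ℕ n` stops at n - 1, and the upper estimate of
  -- an increment uses the right endpoint.
  n^[1+k]≤[1+k][∑i^k+n^k] : ∀ k n → n ^ suc k ≤ suc k * (∑ℕ n (_^ k) + n ^ k)
  n^[1+k]≤[1+k][∑i^k+n^k] k zero    = z≤n
  n^[1+k]≤[1+k][∑i^k+n^k] k (suc n) = begin
    suc n ^ suc k                                          ≤⟨ [1+n]^[1+k]≤n^[1+k]+[1+k][1+n]^k n k ⟩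
    n ^ suc k + suc k * suc n ^ k                          ≤⟨ ℕ.+-monoˡ-≤ (suc k * suc n ^ k) (n^[1+k]≤[1+k][∑i^k+n^k] k n) ⟩
    suc k * (∑ℕ n (_^ k) + n ^ k) + suc k * suc n ^ k      ≡⟨ cong (λ s → suc k * s + suc k * suc n ^ k) (∑ℕ-last n (_^ k)) ⟨
    suc k * ∑ℕ (suc n) (_^ k) + suc k * suc n ^ k          ≡⟨ ℕ.*-distribˡ-+ (suc k) (∑ℕ (suc n) (_^ k)) (suc n ^ k) ⟨
    suc k * (∑ℕ (suc n) (_^ k) + suc n ^ k)                ∎

module _ where
  open import Data.Rational.Base hiding (NonZero)
  open ℚ.≤-Reasoning

  *-assoc-comm : ∀ k e r → k * (e * r) ≡ e * (k * r)
  *-assoc-comm = solve 3 (λ k e r → k :* (e :* r) := e :* (k :* r)) ≡.refl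

  p≡q+[p-q] : ∀ p q → p ≡ q + (p - q)
  p≡q+[p-q] = solve 2 (λ p q → p := q :+ (p :- q)) ≡.refl

  -[p-q]≡q-p : ∀ p q → - (p - q) ≡ q - p
  -[p-q]≡q-p = solve 2 (λ p q → :- (p :- q) := q :- p) ≡.refl

  [p-q]+[q-r]≡p-r : ∀ p q r → (p - q) + (q - r) ≡ p - r
  [p-q]+[q-r]≡p-r = solve 3 (λ p q r → (p :- q) :+ (q :- r) := p :- r) ≡.refl

  [p-q]+[r-s]≡[p+r]-[q+s] : ∀ p q r s → (p - q) + (r - s) ≡ (p + r) - (q + s)
  [p-q]+[r-s]≡[p+r]-[q+s] = solve 4 (λ p q r s → (p :- q) :+ (r :- s) := (p :+ r) :- (q :+ s)) ≡.refl

  -[p-q]≡-p--q : ∀ p q → - (p - q) ≡ - p - - q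
  -[p-q]≡-p--q = solve 2 (λ p q → :- (p :- q) := :- p :- :- q) ≡.refl

  p[r-s]+s[p-q]≡pr-qs : ∀ p q r s → p * (r - s) + s * (p - q) ≡ p * r - q * s
  p[r-s]+s[p-q]≡pr-qs = solve 4 (λ p q r s → p :* (r :- s) :+ s :* (p :- q) := p :* r :- q :* s) ≡.refl

  p[q-r]≡pq-pr : ∀ p q r → p * (q - r) ≡ p * q - p * r
  p[q-r]≡pq-pr = solve 3 (λ p q r → p :* (q :- r) := p :* q :- p :* r) ≡.refl

  -[p-q]+[p-r]≡q-r : ∀ p q r → - (p - q) + (p - r) ≡ q - r
  -[p-q]+[p-r]≡q-r = solve 3 (λ p q r → :- (p :- q) :+ (p :- r) := q :- r) ≡.refl

  nat : ℕ → ℚ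
  nat n = + n / 1

  recip : (n : ℕ) .{{_ : NonZero n}} → ℚ
  recip n = + 1 / n

  -- Division normalises by a gcd that does not reduce on variables, so the basic facts on `nat` and
  -- `recip` are checked on unnormalised fractions.
  toℚᵘ-/ : ∀ i n → toℚᵘ (i / suc n) ℚᵘ.≃ mkℚᵘ i n
  toℚᵘ-/ i n = ℚ.toℚᵘ-fromℚᵘ (mkℚᵘ i n)

  nat-suc : ∀ n → nat (suc n) ≡ 1ℚ + nat n
  nat-suc n = ℚ.toℚᵘ-injective (ℚᵘ.≃-trans (toℚᵘ-/ (+ suc n) 0) (ℚᵘ.≃-trans
    (*≡* (cong (ℤ._* + 1) (cong (ℤ._+_ (+ 1)) (≡.sym (ℤ.*-identityʳ (+ n))))))
    (ℚᵘ.≃-sym (ℚᵘ.≃-trans (ℚ.toℚᵘ-homo-+ 1ℚ (nat n)) (ℚᵘ.+-congʳ (toℚᵘ 1ℚ) (toℚᵘ-/ (+ n) 0))))))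

  nat*recip≡1 : ∀ n .{{_ : NonZero n}} → nat n * recip n ≡ 1ℚ
  nat*recip≡1 (suc n) = ℚ.toℚᵘ-injective (ℚᵘ.≃-trans (ℚ.toℚᵘ-homo-* (nat (suc n)) (recip (suc n)))
    (ℚᵘ.≃-trans (ℚᵘ.*-cong (toℚᵘ-/ (+ suc n) 0) (toℚᵘ-/ (+ 1) n))
      (*≡* (≡.trans (ℤ.*-identityʳ (+ suc n ℤ.* + 1)) (≡.trans (ℤ.*-identityʳ (+ suc n))
        (≡.sym (≡.trans (ℤ.*-identityˡ (+ suc (n ℕ.+ 0))) (cong (λ m → + suc m) (ℕ.+-identityʳ n)))))))))

  nat-+ : ∀ m n → nat (m ℕ.+ n) ≡ nat m + nat n
  nat-+ zero    n = ≡.sym (ℚ.+-identityˡ (nat n))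
  nat-+ (suc m) n = begin-equality
    nat (suc (m ℕ.+ n))       ≡⟨ nat-suc (m ℕ.+ n) ⟩
    1ℚ + nat (m ℕ.+ n)        ≡⟨ cong (_+_ 1ℚ) (nat-+ m n) ⟩
    1ℚ + (nat m + nat n)      ≡⟨ ℚ.+-assoc 1ℚ (nat m) (nat n) ⟨
    (1ℚ + nat m) + nat n      ≡⟨ cong (_+ nat n) (nat-suc m) ⟨
    nat (suc m) + nat n       ∎

  p+qp≡[1+q]p : ∀ p q → p + q * p ≡ (1ℚ + q) * p
  p+qp≡[1+q]p = solve 2 (λ p q → p :+ q :* p := (con 1ℚ :+ q) :* p) ≡.refl

  nat-* : ∀ m n → nat (m ℕ.* n) ≡ nat m * nat n
  nat-* zero    n = ≡.sym (ℚ.*-zeroˡ (nat n))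
  nat-* (suc m) n = begin-equality
    nat (n ℕ.+ m ℕ.* n)       ≡⟨ nat-+ n (m ℕ.* n) ⟩
    nat n + nat (m ℕ.* n)     ≡⟨ cong (_+_ (nat n)) (nat-* m n) ⟩
    nat n + nat m * nat n     ≡⟨ p+qp≡[1+q]p (nat n) (nat m) ⟩
    (1ℚ + nat m) * nat n      ≡⟨ cong (_* nat n) (nat-suc m) ⟨
    nat (suc m) * nat n       ∎

  0≤nat : ∀ n → 0ℚ ≤ nat n
  0≤nat zero    = ℚ.≤-refl
  0≤nat (suc n) = subst (0ℚ ≤_) (≡.sym (nat-suc n))
    (ℚ.+-mono-≤ (ℚ.<⇒≤ (ℚ.positive⁻¹ 1ℚ)) (0≤nat n))

  nat-mono-≤ : ∀ {m n} → m ℕ.≤ n → nat m ≤ nat n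
  nat-mono-≤ {m} {n} m≤n = begin
    nat m                      ≡⟨ ℚ.+-identityʳ (nat m) ⟨
    nat m + 0ℚ                 ≤⟨ ℚ.+-monoʳ-≤ (nat m) (0≤nat (n ℕ.∸ m)) ⟩
    nat m + nat (n ℕ.∸ m)      ≡⟨ nat-+ m (n ℕ.∸ m) ⟨
    nat (m ℕ.+ (n ℕ.∸ m))      ≡⟨ cong nat (ℕ.m+[n∸m]≡n m≤n) ⟩
    nat n                      ∎

  0<recip : ∀ n → 0ℚ < recip (suc n)
  0<recip n = ℚ.toℚᵘ-cancel-< (ℚᵘ.<-respʳ-≃ (ℚᵘ.≃-sym (toℚᵘ-/ (+ 1) n)) (*<* (ℤ.+<+ (s≤s z≤n))))

  archimedean : ∀ q → 0ℚ < q → ∃[ K ] ∀ k → K ℕ.≤ k → recip (suc k) < q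
  archimedean (mkℚ (+ zero) d c)     (ℚ.*<* (ℤ.+<+ ()))
  -- The number is (p+1)/(d+1), at least 1/(d+1), so its denominator d + 1 serves as the threshold.
  archimedean (mkℚ (+ suc p) d c)    _   = suc d , λ k d<k →
    ℚ.toℚᵘ-cancel-< (ℚᵘ.<-respˡ-≃ (ℚᵘ.≃-sym (toℚᵘ-/ (+ 1) k)) (*<* (ℤ.+<+
      (s≤s (ℕ.≤-trans (s≤s (ℕ.≤-reflexive (ℕ.+-identityʳ d))) (ℕ.≤-trans d<k (ℕ.m≤m+n k (p ℕ.* suc k))))))))
  archimedean (mkℚ ℤ.-[1+ p ] d c)   (ℚ.*<* ())

  [1+p]q-pq≡q : ∀ p q → (1ℚ + p) * q - p * q ≡ q
  [1+p]q-pq≡q = solve 2 (λ p q → (con 1ℚ :+ p) :* q :- p :* q := q) ≡.refl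

  *-interchange : ∀ a b c d → (a * b) * (c * d) ≡ (a * c) * (b * d)
  *-interchange = solve 4 (λ a b c d → (a :* b) :* (c :* d) := (a :* c) :* (b :* d)) ≡.refl

  infixr 8 _^ℚ_

  _^ℚ_ : ℚ → ℕ → ℚ
  _^ℚ_ = power _*_ 1ℚ

  [nat*p]^k : ∀ n p k → (nat n * p) ^ℚ k ≡ nat (n ℕ.^ k) * p ^ℚ k
  [nat*p]^k n p zero    = ≡.sym (ℚ.*-identityˡ 1ℚ)
  [nat*p]^k n p (suc k) = begin-equality
    (nat n * p) * (nat n * p) ^ℚ k              ≡⟨ cong ((nat n * p) *_) ([nat*p]^k n p k) ⟩
    (nat n * p) * (nat (n ℕ.^ k) * p ^ℚ k)      ≡⟨ *-interchange (nat n) p (nat (n ℕ.^ k)) (p ^ℚ k) ⟩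
    (nat n * nat (n ℕ.^ k)) * (p * p ^ℚ k)      ≡⟨ cong (_* (p * p ^ℚ k)) (nat-* n (n ℕ.^ k)) ⟨
    nat (n ℕ.* n ℕ.^ k) * (p * p ^ℚ k)          ∎

  1^k≡1 : ∀ k → 1ℚ ^ℚ k ≡ 1ℚ
  1^k≡1 zero    = ≡.refl
  1^k≡1 (suc k) = ≡.trans (ℚ.*-identityˡ (1ℚ ^ℚ k)) (1^k≡1 k)

  nat[n^k]*recip^k≡1 : ∀ n .{{_ : NonZero n}} k → nat (n ℕ.^ k) * recip n ^ℚ k ≡ 1ℚ
  nat[n^k]*recip^k≡1 n k = ≡.trans (≡.sym ([nat*p]^k n (recip n) k))
    (≡.trans (cong (_^ℚ k) (nat*recip≡1 n)) (1^k≡1 k))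

  ∣p-q∣≤r : ∀ p q r → 0ℚ ≤ r → p ≤ q → q ≤ p + r → ∣ p - q ∣ ≤ r
  ∣p-q∣≤r p q r 0≤r p≤q q≤p+r with ℚ.∣p∣≡p∨∣p∣≡-p (p - q)
  ... | inj₁ eq = begin
    ∣ p - q ∣   ≡⟨ eq ⟩
    p - q       ≤⟨ ℚ.+-monoˡ-≤ (- q) p≤q ⟩
    q - q       ≡⟨ ℚ.+-inverseʳ q ⟩
    0ℚ          ≤⟨ 0≤r ⟩
    r           ∎
  ... | inj₂ eq = begin
    ∣ p - q ∣     ≡⟨ eq ⟩
    - (p - q)     ≡⟨ -[p-q]≡q-p p q ⟩
    q - p         ≤⟨ ℚ.+-monoˡ-≤ (- p) q≤p+r ⟩
    p + r - p     ≡⟨ p+r-p≡r p r ⟩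
    r             ∎
    where
    p+r-p≡r : ∀ p r → p + r - p ≡ r
    p+r-p≡r = solve 2 (λ p r → p :+ r :- p := r) ≡.refl

  recip*[nat*p]≡p : ∀ n .{{_ : NonZero n}} p → recip n * (nat n * p) ≡ p
  recip*[nat*p]≡p n p = begin-equality
    recip n * (nat n * p)    ≡⟨ ℚ.*-assoc (recip n) (nat n) p ⟨
    (recip n * nat n) * p    ≡⟨ cong (_* p) (≡.trans (ℚ.*-comm (recip n) (nat n)) (nat*recip≡1 n)) ⟩
    1ℚ * p                   ≡⟨ ℚ.*-identityˡ p ⟩
    p                        ∎

  module _ (K k : ℕ) where
    private
      n = suc K
      h = recip n
      H = h ^ℚ suc k
      S = nat (∑ℕ n (ℕ._^ k)) * H
      v = recip (suc k)
      instance
        H-nonNeg : NonNegative H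
        H-nonNeg = nonNegative (^-nonNeg (suc k))
          where
          ^-nonNeg : ∀ j → 0ℚ ≤ h ^ℚ j
          ^-nonNeg zero    = ℚ.<⇒≤ (ℚ.positive⁻¹ 1ℚ)
          ^-nonNeg (suc j) = begin
            0ℚ            ≡⟨ ℚ.*-zeroʳ h ⟨
            h * 0ℚ        ≤⟨ ℚ.*-monoˡ-≤-nonNeg h {{nonNegative (ℚ.<⇒≤ (0<recip K))}} (^-nonNeg j) ⟩
            h * h ^ℚ j     ∎
        v-nonNeg : NonNegative v
        v-nonNeg = nonNegative (ℚ.<⇒≤ (0<recip k))

      [1+k]S≤1 : nat (suc k) * S ≤ 1ℚ
      [1+k]S≤1 = begin
        nat (suc k) * (nat (∑ℕ n (ℕ._^ k)) * H)     ≡⟨ ℚ.*-assoc (nat (suc k)) (nat (∑ℕ n (ℕ._^ k))) H ⟨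
        (nat (suc k) * nat (∑ℕ n (ℕ._^ k))) * H     ≡⟨ cong (_* H) (nat-* (suc k) (∑ℕ n (ℕ._^ k))) ⟨
        nat (suc k ℕ.* ∑ℕ n (ℕ._^ k)) * H           ≤⟨ ℚ.*-monoʳ-≤-nonNeg H (nat-mono-≤ ([1+k]∑i^k≤n^[1+k] k n)) ⟩
        nat (n ℕ.^ suc k) * H                       ≡⟨ nat[n^k]*recip^k≡1 n (suc k) ⟩
        1ℚ                                          ∎

      1≤[1+k][S+h] : 1ℚ ≤ nat (suc k) * (S + h)
      1≤[1+k][S+h] = begin
        1ℚ
          ≡⟨ nat[n^k]*recip^k≡1 n (suc k) ⟨
        nat (n ℕ.^ suc k) * H
          ≤⟨ ℚ.*-monoʳ-≤-nonNeg H (nat-mono-≤ (n^[1+k]≤[1+k][∑i^k+n^k] k n)) ⟩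
        nat (suc k ℕ.* (∑ℕ n (ℕ._^ k) ℕ.+ n ℕ.^ k)) * H
          ≡⟨ cong (_* H) (≡.trans (nat-* (suc k) (∑ℕ n (ℕ._^ k) ℕ.+ n ℕ.^ k))
               (cong (nat (suc k) *_) (nat-+ (∑ℕ n (ℕ._^ k)) (n ℕ.^ k)))) ⟩
        (nat (suc k) * (nat (∑ℕ n (ℕ._^ k)) + nat (n ℕ.^ k))) * H
          ≡⟨ expand (nat (suc k)) (nat (∑ℕ n (ℕ._^ k))) (nat (n ℕ.^ k)) h (h ^ℚ k) ⟩
        nat (suc k) * (S + h * (nat (n ℕ.^ k) * h ^ℚ k))
          ≡⟨ cong (λ p → nat (suc k) * (S + h * p)) (nat[n^k]*recip^k≡1 n k) ⟩
        nat (suc k) * (S + h * 1ℚ)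
          ≡⟨ cong (λ p → nat (suc k) * (S + p)) (ℚ.*-identityʳ h) ⟩
        nat (suc k) * (S + h) ∎
        where
        expand : ∀ a s m h p → (a * (s + m)) * (h * p) ≡ a * (s * (h * p) + h * (m * p))
        expand = solve 5 (λ a s m h p → (a :* (s :+ m)) :* (h :* p)
                                         := a :* (s :* (h :* p) :+ h :* (m :* p))) ≡.refl

    -- The left Riemann sum `S` of t^k lies below the integral, and adding the endpoint term 1^k
    -- times `h` lifts it above, so the error is at most one step.
    ∣∑i^k/n^[1+k]-1/[1+k]∣≤1/n : ∣ S - v ∣ ≤ h
    ∣∑i^k/n^[1+k]-1/[1+k]∣≤1/n = ∣p-q∣≤r S v h (ℚ.<⇒≤ (0<recip K))
      (begin
        S                             ≡⟨ recip*[nat*p]≡p (suc k) S ⟨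
        v * (nat (suc k) * S)         ≤⟨ ℚ.*-monoˡ-≤-nonNeg v [1+k]S≤1 ⟩
        v * 1ℚ                        ≡⟨ ℚ.*-identityʳ v ⟩
        v                             ∎)
      (begin
        v                             ≡⟨ ℚ.*-identityʳ v ⟨
        v * 1ℚ                        ≤⟨ ℚ.*-monoˡ-≤-nonNeg v 1≤[1+k][S+h] ⟩
        v * (nat (suc k) * (S + h))   ≡⟨ recip*[nat*p]≡p (suc k) (S + h) ⟩
        S + h                         ∎)

-- Rational families tending to zero

-- Ev P: the property P holds eventually along the filter.
module Filter {X : Set} (Ev : (X → Set) → Set)
  (Ev-map : ∀ {P Q : X → Set} → (∀ {x} → P x → Q x) → Ev P → Ev Q)
  (Ev-zip : ∀ {P Q : X → Set} → Ev P → Ev Q → Ev (λ x → P x × Q x))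
  where

  open import Data.Rational.Base
  open ℚ.≤-Reasoning

  -- Equality of reals and convergence of real sequences both say that a family of rational
  -- differences is null, so a single set of closure lemmas serves for the two.
  Null : (X → ℚ) → Set
  Null s = ∀ ε → 0ℚ < ε → Ev (λ x → ∣ s x ∣ < ε)

  Null-resp : ∀ {s t : X → ℚ} → (∀ x → s x ≡ t x) → Null s → Null t
  Null-resp s≡t null ε 0<ε = Ev-map (λ {x} → subst (λ q → ∣ q ∣ < ε) (s≡t x)) (null ε 0<ε)

  Null-neg : ∀ {s : X → ℚ} → Null s → Null (λ x → - s x)
  Null-neg {s} null ε 0<ε = Ev-map (λ {x} → subst (_< ε) (≡.sym (ℚ.∣-p∣≡∣p∣ (s x)))) (null ε 0<ε)

  Null-* : ∀ {c s : X → ℚ} K → 0ℚ < K → Ev (λ x → ∣ c x ∣ ≤ K) → Null s → Null (λ x → c x * s x)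
  Null-* {c} {s} K 0<K bound null ε 0<ε =
    Ev-map (λ {x} → small x) (Ev-zip bound (null (ε * 1/ K) (ℚ.positive⁻¹ (ε * 1/ K))))
    where
    instance
      _ = positive 0<K
      _ = positive 0<ε
      _ = ℚ.pos⇒nonZero K
      _ = ℚ.1/pos⇒pos K
      _ = ℚ.pos*pos⇒pos ε (1/ K)
    small : ∀ x → ∣ c x ∣ ≤ K × ∣ s x ∣ < ε * 1/ K → ∣ c x * s x ∣ < ε
    small x (c≤K , s<) = begin-strict
      ∣ c x * s x ∣          ≡⟨ ℚ.∣p*q∣≡∣p∣*∣q∣ (c x) (s x) ⟩
      ∣ c x ∣ * ∣ s x ∣      ≤⟨ ℚ.*-monoʳ-≤-nonNeg ∣ s x ∣ {{ℚ.∣-∣-nonNeg (s x)}} c≤K ⟩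
      K * ∣ s x ∣            <⟨ ℚ.*-monoʳ-<-pos K s< ⟩
      K * (ε * 1/ K)         ≡⟨ *-assoc-comm K ε (1/ K) ⟩
      ε * (K * 1/ K)         ≡⟨ cong (ε *_) (ℚ.*-inverseʳ K) ⟩
      ε * 1ℚ                 ≡⟨ ℚ.*-identityʳ ε ⟩
      ε                      ∎

  Null-+ : ∀ {s t : X → ℚ} → Null s → Null t → Null (λ x → s x + t x)
  Null-+ {s} {t} null-s null-t ε 0<ε =
    Ev-map (λ {x} → small x) (Ev-zip (null-s η 0<η) (null-t η 0<η))
    where
    η = ε * ½
    0<η : 0ℚ < η
    0<η = ℚ.positive⁻¹ η {{ℚ.pos*pos⇒pos ε {{positive 0<ε}} ½}}
    small : ∀ x → ∣ s x ∣ < η × ∣ t x ∣ < η → ∣ s x + t x ∣ < ε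
    small x (s< , t<) = begin-strict
      ∣ s x + t x ∣          ≤⟨ ℚ.∣p+q∣≤∣p∣+∣q∣ (s x) (t x) ⟩
      ∣ s x ∣ + ∣ t x ∣      <⟨ ℚ.+-mono-< s< t< ⟩
      η + η                  ≡⟨ ℚ.*-distribˡ-+ ε ½ ½ ⟨
      ε * 1ℚ                 ≡⟨ ℚ.*-identityʳ ε ⟩
      ε                      ∎

open import Data.Fin.Base using (zero; suc)
open import Defs

Eventually : (ℕ → Set) → Set
Eventually P = ∃[ N ] ∀ n → N ℕ.≤ n → P n

Eventually-map : ∀ {P Q : ℕ → Set} → (∀ {n} → P n → Q n) → Eventually P → Eventually Q
Eventually-map f (N , p) = N , λ n N≤n → f (p n N≤n)

Eventually-zip : ∀ {P Q : ℕ → Set} → Eventually P → Eventually Q → Eventually (λ n → P n × Q n)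
Eventually-zip (M , p) (N , q) = M ℕ.⊔ N , λ n M⊔N≤n →
  p n (ℕ.m⊔n≤o⇒m≤o M N M⊔N≤n) , q n (ℕ.m⊔n≤o⇒n≤o M N M⊔N≤n)

-- The first index is that of a sequence of reals, the second that of the rational
-- approximations to its terms; how late the latter must start may depend on the former.
Eventually₂ : (ℕ × ℕ → Set) → Set
Eventually₂ P = Eventually λ k → Eventually λ n → P (k , n)

module Null₁ = Filter Eventually Eventually-map Eventually-zip
module Null₂ = Filter Eventually₂ (λ f → Eventually-map (Eventually-map f))
  (λ p q → Eventually-map (λ (p , q) → Eventually-zip p q) (Eventually-zip p q))

-- The commutative ring of real numbers

infix 4 _≈_

-- _≃_ unfolds, so Agda cannot infer its arguments; this copy does not.  Even so,
-- unifying two sums or products of reals compares their Cauchy proofs, so the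
-- implicit arguments are given explicitly below.
record _≈_ (x y : ℝ) : Set where
  constructor ≃⇒≈
  field ≈⇒≃ : x ≃ y

open _≈_ using (≈⇒≃)

seq-≡⇒≈ : ∀ {x y} → (∀ n → seq x n ≡ seq y n) → x ≈ y
seq-≡⇒≈ {x} {y} x≡y = ≃⇒≈ λ ε 0<ε → 0 , λ n _ → subst (ℚ._< ε)
  (≡.sym (cong ℚ.∣_∣ (≡.trans (cong (ℚ._- seq y n) (x≡y n)) (ℚ.+-inverseʳ (seq y n))))) 0<ε

bounded : ∀ x → ∃[ K ] 0ℚ ℚ.< K × Eventually (λ n → ℚ.∣ seq x n ∣ ℚ.≤ K)
bounded x with cauchy x 1ℚ (ℚ.positive⁻¹ 1ℚ)
... | N , p = ℚ.∣ seq x N ∣ ℚ.+ 1ℚ , ℚ.+-mono-≤-< (ℚ.0≤∣p∣ (seq x N)) (ℚ.positive⁻¹ 1ℚ) , N , λ n N≤n → begin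
  ℚ.∣ seq x n ∣                                 ≡⟨ cong ℚ.∣_∣ (p≡q+[p-q] (seq x n) (seq x N)) ⟩
  ℚ.∣ seq x N ℚ.+ (seq x n ℚ.- seq x N) ∣       ≤⟨ ℚ.∣p+q∣≤∣p∣+∣q∣ (seq x N) (seq x n ℚ.- seq x N) ⟩
  ℚ.∣ seq x N ∣ ℚ.+ ℚ.∣ seq x n ℚ.- seq x N ∣   ≤⟨ ℚ.+-monoʳ-≤ ℚ.∣ seq x N ∣ (ℚ.<⇒≤ (p n N N≤n ℕ.≤-refl)) ⟩
  ℚ.∣ seq x N ∣ ℚ.+ 1ℚ                          ∎
  where open ℚ.≤-Reasoning

≈-refl : ∀ {x} → x ≈ x
≈-refl {x} = seq-≡⇒≈ λ _ → ≡.refl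

difference : ℝ → ℝ → ℕ → ℚ
difference x y n = seq x n ℚ.- seq y n

≈⇒Null : ∀ {x y} → x ≈ y → Null₁.Null (difference x y)
≈⇒Null (≃⇒≈ p) = p

Null⇒≈ : ∀ x y {s : ℕ → ℚ} → (∀ n → s n ≡ difference x y n) → Null₁.Null s → x ≈ y
Null⇒≈ x y {s} s≡ null = ≃⇒≈ (Null₁.Null-resp {s} {difference x y} s≡ null)

≈-sym : ∀ {x y} → x ≈ y → y ≈ x
≈-sym {x} {y} p = Null⇒≈ y x (λ n → -[p-q]≡q-p (seq x n) (seq y n))
  (Null₁.Null-neg {difference x y} (≈⇒Null p))

≈-trans : ∀ {x y z} → x ≈ y → y ≈ z → x ≈ z
≈-trans {x} {y} {z} p q = Null⇒≈ x z (λ n → [p-q]+[q-r]≡p-r (seq x n) (seq y n) (seq z n))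
  (Null₁.Null-+ {difference x y} {difference y z} (≈⇒Null p) (≈⇒Null q))

+-cong : ∀ {x y u v} → x ≈ y → u ≈ v → x + u ≈ y + v
+-cong {x} {y} {u} {v} p q = Null⇒≈ (x + u) (y + v)
  (λ n → [p-q]+[r-s]≡[p+r]-[q+s] (seq x n) (seq y n) (seq u n) (seq v n))
  (Null₁.Null-+ {difference x y} {difference u v} (≈⇒Null p) (≈⇒Null q))

neg-cong : ∀ {x y} → x ≈ y → - x ≈ - y
neg-cong {x} {y} p = Null⇒≈ (- x) (- y) (λ n → -[p-q]≡-p--q (seq x n) (seq y n))
  (Null₁.Null-neg {difference x y} (≈⇒Null p))

*-cong : ∀ {x y u v} → x ≈ y → u ≈ v → x * u ≈ y * v
*-cong {x} {y} {u} {v} p q =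
  let K , 0<K , x≤K = bounded x
      L , 0<L , v≤L = bounded v
  in Null⇒≈ (x * u) (y * v)
    (λ n → p[r-s]+s[p-q]≡pr-qs (seq x n) (seq y n) (seq u n) (seq v n))
    (Null₁.Null-+ {λ n → seq x n ℚ.* difference u v n} {λ n → seq v n ℚ.* difference x y n}
      (Null₁.Null-* {seq x} {difference u v} K 0<K x≤K (≈⇒Null q))
      (Null₁.Null-* {seq v} {difference x y} L 0<L v≤L (≈⇒Null p)))

infix 4 _▷_

-- ℚ is an eta record, so Agda unfolds the operations of ℚ even on variables:
-- the values of a sequence are propagated by these lemmas, not by conversion.
record _▷_ (x : ℝ) (s : ℕ → ℚ) : Set where
  constructor values
  field value : ∀ n → seq x n ≡ s n

open _▷_

▷-seq : ∀ x → x ▷ seq x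
▷-seq x = values λ _ → ≡.refl

▷-fromℚ : ∀ q → fromℚ q ▷ (λ _ → q)
▷-fromℚ q = values λ _ → ≡.refl

seq-+ : ∀ x y n → seq (x + y) n ≡ seq x n ℚ.+ seq y n
seq-+ x y n = ≡.refl

seq-* : ∀ x y n → seq (x * y) n ≡ seq x n ℚ.* seq y n
seq-* x y n = ≡.refl

seq-neg : ∀ x n → seq (- x) n ≡ ℚ.- seq x n
seq-neg x n = ≡.refl

▷-+ : ∀ x y {s t} → x ▷ s → y ▷ t → x + y ▷ (λ n → s n ℚ.+ t n)
▷-+ x y p q = values λ n → ≡.trans (seq-+ x y n) (cong₂ ℚ._+_ (value p n) (value q n))

▷-* : ∀ x y {s t} → x ▷ s → y ▷ t → x * y ▷ (λ n → s n ℚ.* t n)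
▷-* x y p q = values λ n → ≡.trans (seq-* x y n) (cong₂ ℚ._*_ (value p n) (value q n))

▷-neg : ∀ x {s} → x ▷ s → - x ▷ (λ n → ℚ.- s n)
▷-neg x p = values λ n → ≡.trans (seq-neg x n) (cong ℚ.-_ (value p n))

▷-resp : ∀ {x s t} → x ▷ s → (∀ n → s n ≡ t n) → x ▷ t
▷-resp p s≡t = values λ n → ≡.trans (value p n) (s≡t n)

▷⇒≈ : ∀ {x y s} → x ▷ s → y ▷ s → x ≈ y
▷⇒≈ {x} {y} p q = seq-≡⇒≈ {x} {y} λ n → ≡.trans (value p n) (≡.sym (value q n))

▷-x+y : ∀ x y → x + y ▷ (λ n → seq x n ℚ.+ seq y n)
▷-x+y x y = ▷-+ x y (▷-seq x) (▷-seq y)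

▷-x*y : ∀ x y → x * y ▷ (λ n → seq x n ℚ.* seq y n)
▷-x*y x y = ▷-* x y (▷-seq x) (▷-seq y)

+-assoc : ∀ x y z → (x + y) + z ≈ x + (y + z)
+-assoc x y z = ▷⇒≈
  (▷-resp (▷-+ (x + y) z (▷-x+y x y) (▷-seq z)) (λ n → ℚ.+-assoc (seq x n) (seq y n) (seq z n)))
  (▷-+ x (y + z) (▷-seq x) (▷-x+y y z))

+-comm : ∀ x y → x + y ≈ y + x
+-comm x y = ▷⇒≈ (▷-resp (▷-x+y x y) (λ n → ℚ.+-comm (seq x n) (seq y n))) (▷-x+y y x)

+-identityˡ : ∀ x → 0ℝ + x ≈ x
+-identityˡ x = ▷⇒≈
  (▷-resp (▷-+ 0ℝ x (▷-fromℚ 0ℚ) (▷-seq x)) (λ n → ℚ.+-identityˡ (seq x n))) (▷-seq x)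

+-inverseˡ : ∀ x → - x + x ≈ 0ℝ
+-inverseˡ x = ▷⇒≈
  (▷-resp (▷-+ (- x) x (▷-neg x (▷-seq x)) (▷-seq x)) (λ n → ℚ.+-inverseˡ (seq x n))) (▷-fromℚ 0ℚ)

*-assoc : ∀ x y z → (x * y) * z ≈ x * (y * z)
*-assoc x y z = ▷⇒≈
  (▷-resp (▷-* (x * y) z (▷-x*y x y) (▷-seq z)) (λ n → ℚ.*-assoc (seq x n) (seq y n) (seq z n)))
  (▷-* x (y * z) (▷-seq x) (▷-x*y y z))

*-comm : ∀ x y → x * y ≈ y * x
*-comm x y = ▷⇒≈ (▷-resp (▷-x*y x y) (λ n → ℚ.*-comm (seq x n) (seq y n))) (▷-x*y y x)

*-identityˡ : ∀ x → 1ℝ * x ≈ x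
*-identityˡ x = ▷⇒≈
  (▷-resp (▷-* 1ℝ x (▷-fromℚ 1ℚ) (▷-seq x)) (λ n → ℚ.*-identityˡ (seq x n))) (▷-seq x)

*-distribˡ-+ : ∀ x y z → x * (y + z) ≈ x * y + x * z
*-distribˡ-+ x y z = ▷⇒≈
  (▷-resp (▷-* x (y + z) (▷-seq x) (▷-x+y y z)) (λ n → ℚ.*-distribˡ-+ (seq x n) (seq y n) (seq z n)))
  (▷-+ (x * y) (x * z) (▷-x*y x y) (▷-x*y x z))

≈-isEquivalence : IsEquivalence _≈_
≈-isEquivalence = record
  { refl = λ {x} → ≈-refl {x}
  ; sym = λ {x} {y} → ≈-sym {x} {y}
  ; trans = λ {x} {y} {z} → ≈-trans {x} {y} {z} }

+-isMagma : IsMagma _≈_ _+_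
+-isMagma = record
  { isEquivalence = ≈-isEquivalence ; ∙-cong = λ {x} {y} {u} {v} → +-cong {x} {y} {u} {v} }

+-isSemigroup : IsSemigroup _≈_ _+_
+-isSemigroup = record { isMagma = +-isMagma ; assoc = +-assoc }

+-identityʳ : ∀ x → x + 0ℝ ≈ x
+-identityʳ x = ≈-trans {x + 0ℝ} {0ℝ + x} {x} (+-comm x 0ℝ) (+-identityˡ x)

+-inverseʳ : ∀ x → x + - x ≈ 0ℝ
+-inverseʳ x = ≈-trans {x + - x} { - x + x} {0ℝ} (+-comm x (- x)) (+-inverseˡ x)

*-identityʳ : ∀ x → x * 1ℝ ≈ x
*-identityʳ x = ≈-trans {x * 1ℝ} {1ℝ * x} {x} (*-comm x 1ℝ) (*-identityˡ x)

*-distribʳ-+ : ∀ x y z → (y + z) * x ≈ y * x + z * x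
*-distribʳ-+ x y z =
  ≈-trans {(y + z) * x} {x * (y + z)} {y * x + z * x} (*-comm (y + z) x)
    (≈-trans {x * (y + z)} {x * y + x * z} {y * x + z * x} (*-distribˡ-+ x y z)
      (+-cong {x * y} {y * x} {x * z} {z * x} (*-comm x y) (*-comm x z)))

+-isMonoid : IsMonoid _≈_ _+_ 0ℝ
+-isMonoid = record { isSemigroup = +-isSemigroup ; identity = +-identityˡ , +-identityʳ }

+-isGroup : IsGroup _≈_ _+_ 0ℝ (-_)
+-isGroup = record
  { isMonoid = +-isMonoid ; inverse = +-inverseˡ , +-inverseʳ
  ; ⁻¹-cong = congruent₁ (-_) (λ x y → neg-cong {x} {y}) }
  where
  -- For a variable f, the unfolding of Congruent₁ does not reach into ℚ.
  congruent₁ : ∀ (f : ℝ → ℝ) → (∀ x y → x ≈ y → f x ≈ f y) → Congruent₁ _≈_ f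
  congruent₁ f f-cong {x} {y} = f-cong x y

+-isAbelianGroup : IsAbelianGroup _≈_ _+_ 0ℝ (-_)
+-isAbelianGroup = record { isGroup = +-isGroup ; comm = +-comm }

+-*-isRing : IsRing _≈_ _+_ _*_ (-_) 0ℝ 1ℝ
+-*-isRing = record
  { +-isAbelianGroup = +-isAbelianGroup
  ; *-cong = λ {x} {y} {u} {v} → *-cong {x} {y} {u} {v}
  ; *-assoc = *-assoc
  ; *-identity = *-identityˡ , *-identityʳ
  ; distrib = *-distribˡ-+ , *-distribʳ-+ }

isCommutativeRing : IsCommutativeRing _≈_ _+_ _*_ (-_) 0ℝ 1ℝ
isCommutativeRing = record { isRing = +-*-isRing ; *-comm = *-comm }

▷-*-const : ∀ x y z p q r → x ▷ (λ _ → p) → y ▷ (λ _ → q) → z ▷ (λ _ → r) → p ℚ.* q ≡ r → x * y ≈ z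
▷-*-const x y z p q r x▷p y▷q z▷r pq≡r =
  ▷⇒≈ {x * y} {z} (▷-resp {x * y} (▷-* x y x▷p y▷q) (λ _ → pq≡r)) z▷r

▷-+-const : ∀ x y z p q r → x ▷ (λ _ → p) → y ▷ (λ _ → q) → z ▷ (λ _ → r) → r ≡ p ℚ.+ q → z ≈ x + y
▷-+-const x y z p q r x▷p y▷q z▷r r≡p+q =
  ▷⇒≈ {z} {x + y} (▷-resp {z} z▷r (λ _ → r≡p+q)) (▷-+ x y x▷p y▷q)

▷-fromℕ : ∀ n → fromℕ n ▷ (λ _ → nat n)
▷-fromℕ n = ▷-fromℚ (nat n)

▷-1ℝ : 1ℝ ▷ (λ _ → 1ℚ)
▷-1ℝ = ▷-fromℚ 1ℚ

fromℕ-zero : fromℕ 0 ≈ 0ℝ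
fromℕ-zero = ▷⇒≈ {fromℕ 0} {0ℝ} (▷-fromℕ 0) (▷-fromℚ (nat 0))

fromℕ-suc : ∀ n → fromℕ (suc n) ≈ 1ℝ + fromℕ n
fromℕ-suc n = ▷-+-const 1ℝ (fromℕ n) (fromℕ (suc n)) 1ℚ (nat n) (nat (suc n))
  ▷-1ℝ (▷-fromℕ n) (▷-fromℕ (suc n)) (nat-suc n)

-- The value at 0 is junk.
inverse : ℕ → ℝ
inverse zero    = 0ℝ
inverse (suc n) = fromℚ (recip (suc n))

▷-inverse : ∀ n → inverse (suc n) ▷ (λ _ → recip (suc n))
▷-inverse n = ▷-fromℚ (recip (suc n))

fromℕ*inverse≈1 : ∀ n → fromℕ (suc n) * inverse (suc n) ≈ 1ℝ
fromℕ*inverse≈1 n = ▷-*-const (fromℕ (suc n)) (inverse (suc n)) 1ℝ (nat (suc n)) (recip (suc n)) 1ℚ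
  (▷-fromℕ (suc n)) (▷-inverse n) ▷-1ℝ (nat*recip≡1 (suc n))

fromℚ[1/n]≡inverse : ∀ n .{{_ : NonZero n}} → fromℚ (ℤ.+ 1 ℚ./ n) ≡ inverse n
fromℚ[1/n]≡inverse (suc n) = ≡.refl

-- Connects division guarded by an instance, as in the statement of the theorem, with the total
-- `inverse` that the abstract algebra expects.
/≡*inverse : ∀ x n .{{_ : NonZero n}} → x / n ≡ x * inverse n
/≡*inverse x n = unfold (inverse n) (fromℚ[1/n]≡inverse n)
  where
  unfold : ∀ q → fromℚ (ℤ.+ 1 ℚ./ n) ≡ q → x / n ≡ x * q
  unfold q ≡.refl = ≡.refl

module Umbralℝ = Umbral _≈_ _+_ _*_ (-_) 0ℝ 1ℝ isCommutativeRing fromℕ fromℕ-zero fromℕ-suc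
module Divisionℝ = Umbralℝ.Division inverse fromℕ*inverse≈1

open Umbralℝ using (∑<)

pow : ℝ → ℕ → ℝ
pow x n = power _*_ 1ℝ x n

^≡power-ℝ : ∀ x n → x ^ n ≡ power _*_ 1ℝ x n
^≡power-ℝ x n = ^≡power ℝ-rawRing x n

-- Limits of sequences of reals

gap : (ℕ → ℝ) → ℝ → ℕ × ℕ → ℚ
gap s I (K , n) = difference (s K) I n

-- Convergence is read off the rational approximations, which replaces real absolute values and the
-- order on ℝ by estimates in ℚ.
record Limit (s : ℕ → ℝ) (I : ℝ) : Set where
  constructor limit
  field Limit⇒Null : Null₂.Null (gap s I)

open Limit

Null⇒Limit : ∀ s I (r : ℕ × ℕ → ℚ) → (∀ K n → r (K , n) ≡ difference (s K) I n) → Null₂.Null r → Limit s I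
Null⇒Limit s I r r≡ null = limit (Null₂.Null-resp {r} {gap s I} (λ (K , n) → r≡ K n) null)

Null₁⇒Null₂ : ∀ (r : ℕ → ℕ → ℚ) → (∀ K → Null₁.Null (r K)) → Null₂.Null (λ (K , n) → r K n)
Null₁⇒Null₂ r null ε 0<ε = 0 , λ K _ → null K ε 0<ε

Limit-cong : ∀ {s t I J} → (∀ K → s K ≈ t K) → I ≈ J → Limit s I → Limit t J
Limit-cong {s} {t} {I} {J} s≈t I≈J l = Null⇒Limit t J
  (λ (K , n) → (difference (t K) (s K) n ℚ.+ difference (s K) I n) ℚ.+ difference I J n)
  (λ K n → ≡.trans
    (cong (ℚ._+ difference I J n) ([p-q]+[q-r]≡p-r (seq (t K) n) (seq (s K) n) (seq I n)))
    ([p-q]+[q-r]≡p-r (seq (t K) n) (seq I n) (seq J n)))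
  (Null₂.Null-+ {λ (K , n) → difference (t K) (s K) n ℚ.+ difference (s K) I n} {λ (K , n) → difference I J n}
    (Null₂.Null-+ {λ (K , n) → difference (t K) (s K) n} {gap s I}
      (Null₁⇒Null₂ (λ K → difference (t K) (s K)) (λ K → ≈⇒Null (≈-sym {s K} {t K} (s≈t K))))
      (Limit⇒Null l))
    (Null₁⇒Null₂ (λ K → difference I J) (λ K → ≈⇒Null I≈J)))

Limit-+ : ∀ {s t I J} → Limit s I → Limit t J → Limit (λ K → s K + t K) (I + J)
Limit-+ {s} {t} {I} {J} l m = Null⇒Limit (λ K → s K + t K) (I + J)
  (λ (K , n) → difference (s K) I n ℚ.+ difference (t K) J n)
  (λ K n → [p-q]+[r-s]≡[p+r]-[q+s] (seq (s K) n) (seq I n) (seq (t K) n) (seq J n))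
  (Null₂.Null-+ {gap s I} {gap t J} (Limit⇒Null l) (Limit⇒Null m))

Limit-* : ∀ c {s I} → Limit s I → Limit (λ K → c * s K) (c * I)
Limit-* c {s} {I} l = let B , 0<B , c≤B = bounded c in Null⇒Limit (λ K → c * s K) (c * I)
  (λ (K , n) → seq c n ℚ.* difference (s K) I n)
  (λ K n → p[q-r]≡pq-pr (seq c n) (seq (s K) n) (seq I n))
  (Null₂.Null-* {λ (K , n) → seq c n} {gap s I} B 0<B (0 , λ _ _ → c≤B) (Limit⇒Null l))

Limit-unique : ∀ {s I J} → Limit s I → Limit s J → I ≈ J
Limit-unique {s} {I} {J} l m = Null⇒≈ I J (λ n → ≡.refl) λ ε 0<ε →
  -- The difference of the two limits does not involve K, so a single K past the threshold suffices.
  let K , p = null ε 0<ε in p K ℕ.≤-refl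
  where
  null : Null₂.Null (λ (K , n) → difference I J n)
  null = Null₂.Null-resp {λ (K , n) → ℚ.- difference (s K) I n ℚ.+ difference (s K) J n} {λ (K , n) → difference I J n}
    (λ (K , n) → -[p-q]+[p-r]≡q-r (seq (s K) n) (seq I n) (seq J n))
    (Null₂.Null-+ {λ (K , n) → ℚ.- difference (s K) I n} {gap s J}
      (Null₂.Null-neg {gap s I} (Limit⇒Null l)) (Limit⇒Null m))

-- Averages over uniform grids and the means of monomials

step : ℕ → ℚ
step K = recip (suc K)

node : ℕ → ℕ → ℚ
node K j = nat j ℚ.* step K

weight : ℕ → ℝ
weight K = fromℚ (step K)

abstract
  uniform : ∀ K → WeightedSum _≈_ _+_ _*_ (Umbralℝ.∑< (suc K)) (λ j → fromℚ (node K j)) (weight K)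
  uniform K = Umbralℝ.equallyWeighted (λ j → fromℚ (node K j)) (weight K) (suc K)

open WeightedSum

-- Only the left sums on uniform grids are required to converge. This follows from Riemann
-- integrability and is evidently preserved by linear combinations.
record Mean (f : ℝ → ℝ) (I : ℝ) : Set where
  constructor mean
  field Mean⇒Limit : Limit (λ K → apply (uniform K) f) I

open Mean

Mean-cong : ∀ {f g I J} → (∀ t → f t ≈ g t) → I ≈ J → Mean f I → Mean g J
Mean-cong {f} {g} {I} {J} f≈g I≈J m = mean
  (Limit-cong {λ K → apply (uniform K) f} {λ K → apply (uniform K) g} {I} {J}
    (λ K → apply-cong (uniform K) f g f≈g) I≈J (Mean⇒Limit m))

Mean-+ : ∀ {f g I J} → Mean f I → Mean g J → Mean (λ t → f t + g t) (I + J)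
Mean-+ {f} {g} {I} {J} l m = mean
  (Limit-cong {λ K → apply (uniform K) f + apply (uniform K) g} {λ K → apply (uniform K) (λ t → f t + g t)} {I + J} {I + J}
    (λ K → ≈-sym {apply (uniform K) (λ t → f t + g t)} {apply (uniform K) f + apply (uniform K) g} (apply-+ (uniform K) f g))
    (≈-refl {I + J}) l+m)
  where
  l+m : Limit (λ K → apply (uniform K) f + apply (uniform K) g) (I + J)
  l+m = Limit-+ {λ K → apply (uniform K) f} {λ K → apply (uniform K) g} {I} {J} (Mean⇒Limit l) (Mean⇒Limit m)

Mean-* : ∀ c {f I} → Mean f I → Mean (λ t → c * f t) (c * I)
Mean-* c {f} {I} m = mean
  (Limit-cong {λ K → c * apply (uniform K) f} {λ K → apply (uniform K) (λ t → c * f t)} {c * I} {c * I}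
    (λ K → ≈-sym {apply (uniform K) (λ t → c * f t)} {c * apply (uniform K) f} (apply-* (uniform K) c f))
    (≈-refl {c * I}) cm)
  where
  cm : Limit (λ K → c * apply (uniform K) f) (c * I)
  cm = Limit-* c {λ K → apply (uniform K) f} {I} (Mean⇒Limit m)

Mean-unique : ∀ {f I J} → Mean f I → Mean f J → I ≈ J
Mean-unique {f} {I} {J} l m = Limit-unique {λ K → apply (uniform K) f} {I} {J} (Mean⇒Limit l) (Mean⇒Limit m)

fromℚ-* : ∀ p q r → p ℚ.* q ≡ r → fromℚ p * fromℚ q ≈ fromℚ r
fromℚ-* p q r = ▷-*-const (fromℚ p) (fromℚ q) (fromℚ r) p q r (▷-fromℚ p) (▷-fromℚ q) (▷-fromℚ r)

fromℚ-cong : ∀ p q → p ≡ q → fromℚ p ≈ fromℚ q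
fromℚ-cong p q ≡.refl = ≈-refl {fromℚ p}

fromℚ-pow : ∀ p k → fromℚ (p ^ℚ k) ≈ pow (fromℚ p) k
fromℚ-pow p k = Umbralℝ.^-hom fromℚ ℚ._*_ 1ℚ (≈-refl {1ℝ}) fromℚ-homo p k
  where
  fromℚ-homo : ∀ p q → fromℚ (p ℚ.* q) ≈ fromℚ p * fromℚ q
  fromℚ-homo p q = ≈-sym {fromℚ p * fromℚ q} {fromℚ (p ℚ.* q)} (fromℚ-* p q (p ℚ.* q) ≡.refl)

powerSum : ℕ → ℕ → ℚ
powerSum K k = nat (∑ℕ (suc K) (ℕ._^ k)) ℚ.* step K ^ℚ suc k

node^k : ∀ K j k → node K j ^ℚ k ≡ nat (j ℕ.^ k) ℚ.* step K ^ℚ k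
node^k K j k = [nat*p]^k j (step K) k

node^k*recip : ∀ K j k → node K j ^ℚ k ℚ.* step K ≡ nat (j ℕ.^ k) ℚ.* step K ^ℚ suc k
node^k*recip K j k = rearrange (node K j ^ℚ k) (nat (j ℕ.^ k)) (step K) (step K ^ℚ k) (node^k K j k)
  where
  rearrange : ∀ p a r s → p ≡ a ℚ.* s → p ℚ.* r ≡ a ℚ.* (r ℚ.* s)
  rearrange p a r s p≡as = ≡.trans (cong (ℚ._* r) p≡as)
    (≡.trans (ℚ.*-assoc a s r) (cong (a ℚ.*_) (ℚ.*-comm s r)))

multiple : ℚ → ℕ → ℝ
multiple q m = fromℚ (nat m ℚ.* q)

▷-multiple : ∀ q m → multiple q m ▷ (λ _ → nat m ℚ.* q)
▷-multiple q m = ▷-fromℚ (nat m ℚ.* q)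

multiple-0 : ∀ q → multiple q 0 ≈ 0ℝ
multiple-0 q = fromℚ-cong (nat 0 ℚ.* q) 0ℚ (ℚ.*-zeroˡ q)

multiple-+ : ∀ q m n → multiple q (m ℕ.+ n) ≈ multiple q m + multiple q n
multiple-+ q m n = ▷-+-const (multiple q m) (multiple q n) (multiple q (m ℕ.+ n))
  (nat m ℚ.* q) (nat n ℚ.* q) (nat (m ℕ.+ n) ℚ.* q)
  (▷-multiple q m) (▷-multiple q n) (▷-multiple q (m ℕ.+ n))
  (≡.trans (cong (ℚ._* q) (nat-+ m n)) (ℚ.*-distribʳ-+ q (nat m) (nat n)))

▷-weight : ∀ K → weight K ▷ (λ _ → step K)
▷-weight K = ▷-fromℚ (step K)

node^k*weight : ∀ K k j → pow (fromℚ (node K j)) k * weight K ≈ multiple (step K ^ℚ suc k) (j ℕ.^ k)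
node^k*weight K k j = *-▷-resp (pow (fromℚ (node K j)) k) (fromℚ (node K j ^ℚ k)) (weight K)
  (multiple (step K ^ℚ suc k) (j ℕ.^ k)) (node K j ^ℚ k) (step K) (nat (j ℕ.^ k) ℚ.* step K ^ℚ suc k)
  (fromℚ-pow (node K j) k) (▷-fromℚ (node K j ^ℚ k)) (▷-weight K)
  (▷-multiple (step K ^ℚ suc k) (j ℕ.^ k)) (node^k*recip K j k)
  where
  *-▷-resp : ∀ x y w z p q r → y ≈ x → y ▷ (λ _ → p) → w ▷ (λ _ → q) → z ▷ (λ _ → r) → p ℚ.* q ≡ r → x * w ≈ z
  *-▷-resp x y w z p q r y≈x y▷p w▷q z▷r pq≡r = ≈-trans {x * w} {y * w} {z}
    (*-cong {x} {y} {w} {w} (≈-sym {y} {x} y≈x) (≈-refl {w})) (▷-*-const y w z p q r y▷p w▷q z▷r pq≡r)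

apply-pow : ∀ K k → apply (uniform K) (λ t → pow t k) ≈ fromℚ (powerSum K k)
apply-pow K k = Umbralℝ.apply-hom {suc K} {λ j → fromℚ (node K j)} {weight K} (uniform K) (λ t → pow t k) (multiple H) (ℕ._^ k)
  (node^k*weight K k) (multiple-0 H) (multiple-+ H)
  where
  H = step K ^ℚ suc k

Mean-pow : ∀ k → Mean (λ t → pow t k) (inverse (suc k))
Mean-pow k = mean (Limit-cong {λ K → fromℚ (powerSum K k)} {λ K → apply (uniform K) (λ t → pow t k)}
  {inverse (suc k)} {inverse (suc k)}
  (λ K → ≈-sym {apply (uniform K) (λ t → pow t k)} {fromℚ (powerSum K k)} (apply-pow K k))
  (≈-refl {inverse (suc k)}) lim)
  where
  lim : Limit (λ K → fromℚ (powerSum K k)) (inverse (suc k))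
  lim = Null⇒Limit (λ K → fromℚ (powerSum K k)) (inverse (suc k))
    (λ (K , _) → powerSum K k ℚ.- recip (suc k)) (λ K n → ≡.refl)
    -- Both reals are constant sequences, so the approximation index may start at 0 and only the
    -- step 1/(K+1) has to be small.
    λ ε 0<ε → let N , p = archimedean ε 0<ε in N , λ K N≤K → 0 , λ _ _ →
      ℚ.≤-<-trans (∣∑i^k/n^[1+k]-1/[1+k]∣≤1/n K k) (p K N≤K)

-- From Riemann integrals to averages over uniform grids

sum≈∑< : ∀ m (v : Fin m → ℝ) (f : ℕ → ℝ) → (∀ i → v i ≈ f (toℕ i)) → sum {m} v ≈ ∑< m f
sum≈∑< m v f v≈f = Umbralℝ.sum≈∑< m v f v≈f

0<½ε : ∀ ε → 0ℚ ℚ.< ε → 0ℚ ℚ.< ε ℚ.* ℚ.½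
0<½ε ε 0<ε = ℚ.positive⁻¹ (ε ℚ.* ℚ.½) {{ℚ.pos*pos⇒pos ε {{ℚ.positive 0<ε}} ℚ.½}}

½ε+½ε≡ε : ∀ ε → ε ℚ.* ℚ.½ ℚ.+ ε ℚ.* ℚ.½ ≡ ε
½ε+½ε≡ε ε = ≡.trans (≡.sym (ℚ.*-distribˡ-+ ε ℚ.½ ℚ.½)) (ℚ.*-identityʳ ε)

½ε<ε : ∀ ε → 0ℚ ℚ.< ε → 0ℚ ℚ.+ ε ℚ.* ℚ.½ ℚ.< ε
½ε<ε ε 0<ε = subst (0ℚ ℚ.+ ε ℚ.* ℚ.½ ℚ.<_) (½ε+½ε≡ε ε)
  (ℚ.+-monoˡ-< (ε ℚ.* ℚ.½) (0<½ε ε 0<ε))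

p<q+ε : ∀ p q ε → p ℚ.≤ q → 0ℚ ℚ.< ε → p ℚ.< q ℚ.+ ε
p<q+ε p q ε p≤q 0<ε = subst (ℚ._< q ℚ.+ ε) (ℚ.+-identityʳ p) (ℚ.+-mono-≤-< p≤q 0<ε)

fromℚ-mono-≤ : ∀ p q → p ℚ.≤ q → fromℚ p ≤ fromℚ q
fromℚ-mono-≤ p q p≤q ε 0<ε = 0 , λ _ _ → p<q+ε p q ε p≤q 0<ε

0<fromℚ : ∀ ε → 0ℚ ℚ.< ε → 0ℝ < fromℚ ε
0<fromℚ ε 0<ε = ε ℚ.* ℚ.½ , 0<½ε ε 0<ε , 0 , λ _ _ → ½ε<ε ε 0<ε

-- The strict order on ℝ demands a fixed rational gap. As δ eventually exceeds η while `h` is below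
-- half of it, the other half is the gap.
const-< : ∀ w δ h → w ▷ (λ _ → h) → ∀ η → 0ℚ ℚ.< η → h ℚ.< η ℚ.* ℚ.½ →
          Eventually (λ n → seq 0ℝ n ℚ.+ η ℚ.< seq δ n) → w < δ
const-< w δ h w▷h η 0<η h<½η (N , p) = η ℚ.* ℚ.½ , 0<½ε η 0<η , N , λ n N≤n → begin-strict
  seq w n ℚ.+ η ℚ.* ℚ.½         ≡⟨ cong (ℚ._+ η ℚ.* ℚ.½) (_▷_.value w▷h n) ⟩
  h ℚ.+ η ℚ.* ℚ.½               <⟨ ℚ.+-monoˡ-< (η ℚ.* ℚ.½) h<½η ⟩
  η ℚ.* ℚ.½ ℚ.+ η ℚ.* ℚ.½       ≡⟨ ½ε+½ε≡ε η ⟩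
  η                             ≡⟨ ℚ.+-identityˡ η ⟨
  0ℚ ℚ.+ η                      <⟨ p n N≤n ⟩
  seq δ n                       ∎
  where open ℚ.≤-Reasoning

∣-∣-close : ∀ x y ε → ∣ x - y ∣ < fromℚ ε → Eventually (λ n → ℚ.∣ difference x y n ∣ ℚ.< ε)
∣-∣-close x y ε (ε′ , 0<ε′ , N , p) = N , λ n N≤n →
  ℚ.≤-<-trans (p≤p+ε (ℚ.∣ difference x y n ∣)) (p n N≤n)
  where
  p≤p+ε : ∀ p → p ℚ.≤ p ℚ.+ ε′
  p≤p+ε p = subst (ℚ._≤ p ℚ.+ ε′) (ℚ.+-identityʳ p) (ℚ.+-monoʳ-≤ p (ℚ.<⇒≤ 0<ε′))

open TaggedPartition

node-0 : ∀ K → node K 0 ≡ 0ℚ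
node-0 K = ℚ.*-zeroˡ (step K)

node-last : ∀ K → node K (suc K) ≡ 1ℚ
node-last K = nat*recip≡1 (suc K)

node-suc-minus : ∀ K j → node K (suc j) ℚ.- node K j ≡ step K
node-suc-minus K j = minus (nat j) (nat (suc j)) (step K) (nat-suc j)
  where
  minus : ∀ a b h → b ≡ 1ℚ ℚ.+ a → b ℚ.* h ℚ.- a ℚ.* h ≡ h
  minus a b h b≡1+a = ≡.trans (cong (λ c → c ℚ.* h ℚ.- a ℚ.* h) b≡1+a) ([1+p]q-pq≡q a h)

node-mono : ∀ K j → node K j ℚ.≤ node K (suc j)
node-mono K j = ℚ.*-monoʳ-≤-nonNeg (step K) {{ℚ.nonNegative (ℚ.<⇒≤ (0<recip K))}} (nat-mono-≤ (ℕ.n≤1+n j))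

▷-width : ∀ {a b} (P : TaggedPartition a b) i p q r → point P (suc i) ≡ fromℚ p →
          point P (inject₁ i) ≡ fromℚ q → p ℚ.- q ≡ r → width P i ▷ (λ _ → r)
▷-width P i p q r pi≡p pj≡q p-q≡r = ▷-resp {point P (suc i) + - point P (inject₁ i)}
  (▷-+ (point P (suc i)) (- point P (inject₁ i)) (▷-≡ (point P (suc i)) p pi≡p)
    (▷-neg (point P (inject₁ i)) (▷-≡ (point P (inject₁ i)) q pj≡q))) (λ _ → p-q≡r)
  where
  ▷-≡ : ∀ x p → x ≡ fromℚ p → x ▷ (λ _ → p)
  ▷-≡ x p ≡.refl = ▷-fromℚ p

abstract
  -- Tags are left endpoints, so the Riemann sum runs over the nodes 0, ..., K of `uniform`. The
  -- record is sealed and used through its size, tags and widths.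
  partition : ℕ → TaggedPartition 0ℝ 1ℝ
  partition K = record
    { size  = suc K
    ; point = λ i → fromℚ (node K (toℕ i))
    ; tag   = λ i → fromℚ (node K (toℕ i))
    ; first = ≈⇒≃ (fromℚ-cong (node K 0) 0ℚ (node-0 K))
    ; last  = ≈⇒≃ (fromℚ-cong (node K (toℕ (Fin.fromℕ (suc K)))) 1ℚ
        (≡.trans (cong (node K) (Fin.toℕ-fromℕ (suc K))) (node-last K)))
    ; lower = λ i → fromℚ-mono-≤ (node K (toℕ (inject₁ i))) (node K (toℕ i))
        (ℚ.≤-reflexive (cong (node K) (Fin.toℕ-inject₁ i)))
    ; upper = λ i → fromℚ-mono-≤ (node K (toℕ i)) (node K (suc (toℕ i))) (node-mono K (toℕ i))
    }

  size-partition : ∀ K → size (partition K) ≡ suc K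
  size-partition K = ≡.refl

  tag-partition : ∀ K i → tag (partition K) i ≡ fromℚ (node K (toℕ i))
  tag-partition K i = ≡.refl

  width-partition : ∀ K i → width (partition K) i ▷ (λ _ → step K)
  width-partition K i = ▷-width (partition K) i (node K (suc (toℕ i))) (node K (toℕ (inject₁ i))) (step K)
    ≡.refl ≡.refl
    (≡.trans (cong (λ j → node K (suc (toℕ i)) ℚ.- node K j) (Fin.toℕ-inject₁ i)) (node-suc-minus K (toℕ i)))

riemannSum-partition : ∀ K f → riemannSum (partition K) f ≈ apply (uniform K) f
riemannSum-partition K f = ≈-trans {riemannSum (partition K) f}
  {∑< (size (partition K)) (λ j → f (fromℚ (node K j)) * weight K)} {apply (uniform K) f}
  (sum≈∑< (size (partition K)) (λ i → f (tag (partition K) i) * width (partition K) i)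
    (λ j → f (fromℚ (node K j)) * weight K)
    (λ i → term (tag (partition K) i) (fromℚ (node K (toℕ i))) (width (partition K) i)
      (tag-partition K i) (width-partition K i)))
  -- Because the partition is sealed, its size equals K + 1 only by a proved equation, along which
  -- the sum is transported.
  (resize (size-partition K))
  where
  term : ∀ t u w → t ≡ u → w ▷ (λ _ → step K) → f t * w ≈ f u * weight K
  term t u w ≡.refl w▷h = *-cong {f t} {f t} {w} {weight K} (≈-refl {f t}) (▷⇒≈ {w} {weight K} w▷h (▷-weight K))
  resize : ∀ {m} → m ≡ suc K → ∑< m (λ j → f (fromℚ (node K j)) * weight K) ≈ apply (uniform K) f
  resize ≡.refl = apply-def (uniform K) f

IsIntegral⇒Mean : ∀ f I → IsIntegral 0ℝ 1ℝ f I → Mean f I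
IsIntegral⇒Mean f I integral = mean
  (Limit-cong {λ K → riemannSum (partition K) f} {λ K → apply (uniform K) f} {I} {I}
    (λ K → riemannSum-partition K f) (≈-refl {I}) lim)
  where
  lim : Limit (λ K → riemannSum (partition K) f) I
  lim = limit λ ε 0<ε →
    let δ , (η , 0<η , η<δ) , close = integral (fromℚ ε) (0<fromℚ ε 0<ε)
        -- The rational η witnesses 0 < δ; a step below η/2 leaves the gap that `const-<` requires
        -- for the mesh condition.
        N , small = archimedean (η ℚ.* ℚ.½) (0<½ε η 0<η)
    in N , λ K N≤K → ∣-∣-close (riemannSum (partition K) f) I ε
         (close (partition K) λ i → const-< (width (partition K) i) δ (step K)
           (width-partition K i) η 0<η (small K N≤K) η<δ)

-- Matching the definitions with the abstract algebra

sum-≈ : ∀ n (f g : ℕ → ℝ) → (∀ i → f i ≈ g i) → sum {n} (λ i → f (toℕ i)) ≈ bigop _+_ 0ℝ n g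
sum-≈ n f g f≈g = sum≈∑< n (λ i → f (toℕ i)) g (λ i → f≈g (toℕ i))

∑[0≤i≤]-≈ : ∀ n (f g : ℕ → ℝ) → (∀ i → f i ≈ g i) → ∑[0≤i≤ n ] f ≈ bigop _+_ 0ℝ (suc n) g
∑[0≤i≤]-≈ n f g f≈g = sum-≈ (suc n) f g f≈g

∑[1≤m≤]-≈ : ∀ n (f : (m : ℕ) .{{_ : NonZero m}} → ℝ) (g : ℕ → ℝ) → (∀ i → f (suc i) ≈ g i) →
            ∑[1≤m≤ n ] f ≈ bigop _+_ 0ℝ n g
∑[1≤m≤]-≈ n f g f≈g = sum≈∑< n (λ i → f (suc (toℕ i))) g (λ i → f≈g (toℕ i))

⊛-≈ : ∀ (f g f′ g′ : ℕ → ℝ) n → (∀ i → f i ≈ f′ i) → (∀ i → g i ≈ g′ i) →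
      (f ⊛ g) n ≈ bigop _+_ 0ℝ (suc n) (λ i → f′ i * g′ (n ∸ i))
⊛-≈ f g f′ g′ n f≈f′ g≈g′ = ∑[0≤i≤]-≈ n (λ i → f i * g (n ∸ i)) (λ i → f′ i * g′ (n ∸ i))
  (λ i → *-cong {f i} {f′ i} {g (n ∸ i)} {g′ (n ∸ i)} (f≈f′ i) (g≈g′ (n ∸ i)))

≡⇒≈ : ∀ {x y} → x ≡ y → x ≈ y
≡⇒≈ {x} ≡.refl = ≈-refl {x}

egf-≡ : ∀ a n → egf a n ≡ a n * inverse (n !)
egf-≡ a n = /≡*inverse (a n) (n !) {{n ℕ.!≢0}}

binom-≡ : ∀ z n → binom z n ≡ falling z n * inverse (n !)
binom-≡ z n = /≡*inverse (falling z n) (n !) {{n ℕ.!≢0}}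

exp-≈ : ∀ x n → exp x n ≈ power _*_ 1ℝ x n * inverse (n !)
exp-≈ x n = ≈-trans {exp x n} {x ^ n * inverse (n !)} {power _*_ 1ℝ x n * inverse (n !)}
  (≡⇒≈ {exp x n} {x ^ n * inverse (n !)} (egf-≡ (x ^_) n))
  (*-cong {x ^ n} {power _*_ 1ℝ x n} {inverse (n !)} {inverse (n !)}
    (≡⇒≈ {x ^ n} {power _*_ 1ℝ x n} (^≡power-ℝ x n)) (≈-refl {inverse (n !)}))

exp1⊖𝟙-≈ : ∀ n → (exp 1ℝ ⊖ 𝟙) n ≈ power _*_ 1ℝ 1ℝ n * inverse (n !) + - 𝟙 n
exp1⊖𝟙-≈ n = +-cong {exp 1ℝ n} {power _*_ 1ℝ 1ℝ n * inverse (n !)} { - 𝟙 n} { - 𝟙 n} (exp-≈ 1ℝ n) (≈-refl { - 𝟙 n})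

bernoulli-≈ : ∀ (B : ℕ → ℝ → ℝ) → IsBernoulliPolynomial B → ∀ x n →
  bigop _+_ 0ℝ (suc n) (λ i → 𝕥 i * (power _*_ 1ℝ x (n ∸ i) * inverse ((n ∸ i) !))) ≈
  bigop _+_ 0ℝ (suc n) (λ i → (power _*_ 1ℝ 1ℝ i * inverse (i !) + - 𝟙 i) * (B (n ∸ i) x * inverse ((n ∸ i) !)))
bernoulli-≈ B isB x n = ≈-trans
  {bigop _+_ 0ℝ (suc n) (λ i → 𝕥 i * (power _*_ 1ℝ x (n ∸ i) * inverse ((n ∸ i) !)))} {(𝕥 ⊛ exp x) n}
  {bigop _+_ 0ℝ (suc n) (λ i → (power _*_ 1ℝ 1ℝ i * inverse (i !) + - 𝟙 i) * (B (n ∸ i) x * inverse ((n ∸ i) !)))}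
  (≈-sym {(𝕥 ⊛ exp x) n} {bigop _+_ 0ℝ (suc n) (λ i → 𝕥 i * (power _*_ 1ℝ x (n ∸ i) * inverse ((n ∸ i) !)))}
    (⊛-≈ 𝕥 (exp x) 𝕥 (λ i → power _*_ 1ℝ x i * inverse (i !)) n (λ i → ≈-refl {𝕥 i}) (exp-≈ x)))
  (≈-trans {(𝕥 ⊛ exp x) n} {((exp 1ℝ ⊖ 𝟙) ⊛ egf (λ n → B n x)) n}
    {bigop _+_ 0ℝ (suc n) (λ i → (power _*_ 1ℝ 1ℝ i * inverse (i !) + - 𝟙 i) * (B (n ∸ i) x * inverse ((n ∸ i) !)))}
    (≃⇒≈ (isB x n))
    (⊛-≈ (exp 1ℝ ⊖ 𝟙) (egf (λ n → B n x)) (λ i → power _*_ 1ℝ 1ℝ i * inverse (i !) + - 𝟙 i) (λ i → B i x * inverse (i !)) n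
      exp1⊖𝟙-≈ (λ i → ≡⇒≈ {egf (λ n → B n x) i} {B i x * inverse (i !)} (egf-≡ (λ n → B n x) i))))

genStirling₂-≈ : ∀ x n m → genStirling₂ n m x ≈
  bigop _+_ 0ℝ (suc (n ∸ m)) (λ i → fromℕ (n C i) * fromℕ (stirling₂ (n ∸ i) m) * power _*_ 1ℝ x i)
genStirling₂-≈ x n m = ∑[0≤i≤]-≈ (n ∸ m)
  (λ i → fromℕ (n C i) * fromℕ (stirling₂ (n ∸ i) m) * x ^ i)
  (λ i → fromℕ (n C i) * fromℕ (stirling₂ (n ∸ i) m) * power _*_ 1ℝ x i)
  (λ i → *-cong {fromℕ (n C i) * fromℕ (stirling₂ (n ∸ i) m)} {fromℕ (n C i) * fromℕ (stirling₂ (n ∸ i) m)} {x ^ i} {power _*_ 1ℝ x i}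
    (≈-refl {fromℕ (n C i) * fromℕ (stirling₂ (n ∸ i) m)}) (≡⇒≈ {x ^ i} {power _*_ 1ℝ x i} (^≡power-ℝ x i)))

minus-≡ : ∀ x y → x - y ≡ x + - y
minus-≡ x y = ≡.refl

falling-suc : ∀ z n → falling z (suc n) ≈ falling z n * (z + - fromℕ n)
falling-suc z n = ≡⇒≈ {falling z (suc n)} {falling z n * (z + - fromℕ n)} (expand (z + - fromℕ n) (minus-≡ z (fromℕ n)))
  where
  expand : ∀ w → z - fromℕ n ≡ w → falling z (suc n) ≡ falling z n * w
  expand w ≡.refl = ≡.refl

Mean-falling : ∀ (z : ℝ → ℝ) (w : ℝ → ℝ) m I → (∀ t → z t ≡ w t) →
  IsIntegral 0ℝ 1ℝ (λ t → binom (z t) m) I → Mean (λ t → falling (w t) m * inverse (m !)) I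
Mean-falling z w m I z≡w integral =
  Mean-cong {λ t → binom (z t) m} {λ t → falling (w t) m * inverse (m !)} {I} {I}
    (λ t → binom-≈ (z t) (w t) (z≡w t)) (≈-refl {I}) (IsIntegral⇒Mean (λ t → binom (z t) m) I integral)
  where
  binom-≈ : ∀ z w → z ≡ w → binom z m ≈ falling w m * inverse (m !)
  binom-≈ z w ≡.refl = ≡⇒≈ {binom z m} {falling z m * inverse (m !)} (binom-≡ z m)

module BernoulliCauchy (B : ℕ → ℝ → ℝ) (isB : IsBernoulliPolynomial B) (x : ℝ) = Divisionℝ.Mean
  Mean
  (λ {f} {g} {I} {J} → Mean-cong {f} {g} {I} {J})
  (λ {f} {g} {I} {J} → Mean-+ {f} {g} {I} {J})
  (λ c {f} {I} → Mean-* c {f} {I})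
  (λ {f} {I} {J} → Mean-unique {f} {I} {J})
  Mean-pow
  falling
  (λ z → ≈-refl {1ℝ})
  falling-suc
  x
  (λ n m → genStirling₂ n m x)
  (genStirling₂-≈ x)
  𝟙 𝕥 (λ n → B n x)
  (≈-refl {1ℝ}) (λ n → ≈-refl {0ℝ})
  (≈-refl {0ℝ}) (≈-refl {1ℝ}) (λ n → ≈-refl {0ℝ})
  (bernoulli-≈ B isB x)

cauchy₁-≈ : ∀ B → IsBernoulliPolynomial B → ∀ x (I a : ℕ → ℝ) →
  (∀ m → Mean (λ t → falling (t + - x) m * inverse (m !)) (I m)) →
  (∀ m → a m ≈ fromℕ (m !) * I m) → ∀ n →
  - (B (suc n) x * inverse (suc n)) ≈
  bigop _+_ 0ℝ (suc n) (λ m → (a (suc m) * inverse (suc m)) * genStirling₂ n m x)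
cauchy₁-≈ B isB x I a = BernoulliCauchy.cauchy₁-bernoulli B isB x I a

cauchy₂-≈ : ∀ B → IsBernoulliPolynomial B → ∀ x (I a : ℕ → ℝ) →
  (∀ m → Mean (λ t → falling (- x + - t) m * inverse (m !)) (I m)) →
  (∀ m → a m ≈ fromℕ (m !) * I m) → ∀ n →
  (power _*_ 1ℝ (- 1ℝ) (suc n) + - B (suc n) x) * inverse (suc n) ≈
  bigop _+_ 0ℝ (suc n) (λ m → (a (suc m) * inverse (suc m)) * genStirling₂ n m x)
cauchy₂-≈ B isB x I a = BernoulliCauchy.cauchy₂-bernoulli B isB x I a

∑-≈ : ∀ (a : ℕ → ℝ) x k →
  ∑[1≤m≤ suc k ] (λ m → (a m / m) * genStirling₂ (suc k ∸ 1) (m ∸ 1) x) ≈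
  bigop _+_ 0ℝ (suc k) (λ m → (a (suc m) * inverse (suc m)) * genStirling₂ k m x)
∑-≈ a x k = ∑[1≤m≤]-≈ (suc k) (λ m {{nz}} → (a m / m) {{nz}} * genStirling₂ (suc k ∸ 1) (m ∸ 1) x)
  (λ m → (a (suc m) * inverse (suc m)) * genStirling₂ k m x) term
  where
  div : ∀ m → a (suc m) / suc m ≈ a (suc m) * inverse (suc m)
  div m = ≡⇒≈ {a (suc m) / suc m} {a (suc m) * inverse (suc m)} (/≡*inverse (a (suc m)) (suc m))
  gs : ∀ m → genStirling₂ (suc k ∸ 1) (suc m ∸ 1) x ≈ genStirling₂ k m x
  gs m = ≡⇒≈ {genStirling₂ (suc k ∸ 1) (suc m ∸ 1) x} {genStirling₂ k m x}
    (cong₂ (λ i j → genStirling₂ i j x) {suc k ∸ 1} {k} {suc m ∸ 1} {m} ≡.refl ≡.refl)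
  term : ∀ m → (a (suc m) / suc m) * genStirling₂ (suc k ∸ 1) (suc m ∸ 1) x ≈
               (a (suc m) * inverse (suc m)) * genStirling₂ k m x
  term m = *-cong {a (suc m) / suc m} {a (suc m) * inverse (suc m)}
    {genStirling₂ (suc k ∸ 1) (suc m ∸ 1) x} {genStirling₂ k m x} (div m) (gs m)

div-minus-≈ : ∀ {a p} b n .{{nz : NonZero n}} → a ≡ p → ((a - b) / n) {{nz}} ≈ (p + - b) * inverse n
div-minus-≈ {a} {.a} b n {{nz}} ≡.refl = ≡⇒≈ {((a - b) / n) {{nz}}} {(a + - b) * inverse n}
  (≡.trans (unfold (inverse n) (fromℚ[1/n]≡inverse n {{nz}})) (cong (λ x → x * inverse n) {a - b} {a + - b} (minus-≡ a b)))
  where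
  unfold : ∀ q → fromℚ ((ℤ.+ 1 ℚ./ n) {{nz}}) ≡ q → ((a - b) / n) {{nz}} ≡ (a - b) * q
  unfold q ≡.refl = ≡.refl

[-1]^n-b/n : ∀ n .{{nz : NonZero n}} b → (((- 1ℝ) ^ n - b) / n) {{nz}} ≈ (power _*_ 1ℝ (- 1ℝ) n + - b) * inverse n
[-1]^n-b/n n {{nz}} b =
  -- The let makes Agda infer the type instead of unifying it with the goal,
  -- which would unfold _^_.
  let p = div-minus-≈ b n {{nz}} (^≡power-ℝ (- 1ℝ) n) in p

n≡suc : ∀ n .{{_ : NonZero n}} → ∃[ k ] n ≡ suc k
n≡suc (suc k) = k , ≡.refl

theorem7 : (c ĉ B : ℕ → ℝ → ℝ) →
    IsCauchyPolynomial₁ c → IsCauchyPolynomial₂ ĉ → IsBernoulliPolynomial B →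
    (n : ℕ) .{{_ : NonZero n}} (x : ℝ) →
    (- (B n x / n) ≃ ∑[1≤m≤ n ] (λ m → (c m x / m) * genStirling₂ (n ∸ 1) (m ∸ 1) x))
    × (((- 1ℝ) ^ n - B n x) / n ≃ ∑[1≤m≤ n ] (λ m → (ĉ m (- x) / m) * genStirling₂ (n ∸ 1) (m ∸ 1) x))
theorem7 c ĉ B isC isĈ isB n {{nz}} x =
    ≈⇒≃ (≈-trans { - (B n x / n) {{nz}}} { - (B n x * inverse n)}
      (neg-cong {(B n x / n) {{nz}}} {B n x * inverse n} (div (B n x)))
      (cauchy₁ n (proj₁ (n≡suc n)) (proj₂ (n≡suc n))))
  , ≈⇒≃ (≈-trans {_} {(power _*_ 1ℝ (- 1ℝ) n + - B n x) * inverse n}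
      ([-1]^n-b/n n (B n x)) (cauchy₂ n (proj₁ (n≡suc n)) (proj₂ (n≡suc n))))
  where
  div : ∀ a → (a / n) {{nz}} ≈ a * inverse n
  div a = ≡⇒≈ {(a / n) {{nz}}} {a * inverse n} (unfold (inverse n) (fromℚ[1/n]≡inverse n {{nz}}))
    where
    unfold : ∀ q → fromℚ ((ℤ.+ 1 ℚ./ n) {{nz}}) ≡ q → (a / n) {{nz}} ≡ a * q
    unfold q ≡.refl = ≡.refl
  -- The abstract identities are indexed by the predecessor k of n; matching on the equation makes n
  -- ∸ 1 reduce to k.
  cauchy₁ : ∀ n k → n ≡ suc k →
    - (B n x * inverse n) ≈ ∑[1≤m≤ n ] (λ m → (c m x / m) * genStirling₂ (n ∸ 1) (m ∸ 1) x)
  cauchy₁ _ k ≡.refl = ≈-trans { - (B (suc k) x * inverse (suc k))}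
    {bigop _+_ 0ℝ (suc k) (λ m → (c (suc m) x * inverse (suc m)) * genStirling₂ k m x)}
    (cauchy₁-≈ B isB x (λ m → proj₁ (isC m x)) (λ m → c m x)
      (λ m → Mean-falling (λ t → t - x) (λ t → t + - x) m (proj₁ (isC m x)) (λ t → minus-≡ t x)
        (proj₁ (proj₂ (isC m x))))
      (λ m → ≃⇒≈ (proj₂ (proj₂ (isC m x)))) k)
    (≈-sym {_}
      {bigop _+_ 0ℝ (suc k) (λ m → (c (suc m) x * inverse (suc m)) * genStirling₂ k m x)} (∑-≈ (λ m → c m x) x k))
  cauchy₂-∑< : ∀ k → (power _*_ 1ℝ (- 1ℝ) (suc k) + - B (suc k) x) * inverse (suc k) ≈
      bigop _+_ 0ℝ (suc k) (λ m → (ĉ (suc m) (- x) * inverse (suc m)) * genStirling₂ k m x)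
  -- The polynomials of the second kind are taken at -x, so the falling factorials have base -x - t,
  -- and adding x leaves -t.
  cauchy₂-∑< k = cauchy₂-≈ B isB x (λ m → proj₁ (isĈ m (- x))) (λ m → ĉ m (- x))
        (λ m → Mean-falling (λ t → - x - t) (λ t → - x + - t) m (proj₁ (isĈ m (- x))) (λ t → minus-≡ (- x) t)
          (proj₁ (proj₂ (isĈ m (- x)))))
        (λ m → ≃⇒≈ (proj₂ (proj₂ (isĈ m (- x))))) k
  cauchy₂ : ∀ n k → n ≡ suc k → (power _*_ 1ℝ (- 1ℝ) n + - B n x) * inverse n ≈
    ∑[1≤m≤ n ] (λ m → (ĉ m (- x) / m) * genStirling₂ (n ∸ 1) (m ∸ 1) x)
  cauchy₂ _ k ≡.refl = ≈-trans {(power _*_ 1ℝ (- 1ℝ) (suc k) + - B (suc k) x) * inverse (suc k)}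
      {bigop _+_ 0ℝ (suc k) (λ m → (ĉ (suc m) (- x) * inverse (suc m)) * genStirling₂ k m x)}
      (cauchy₂-∑< k)
      (≈-sym {_}
        {bigop _+_ 0ℝ (suc k) (λ m → (ĉ (suc m) (- x) * inverse (suc m)) * genStirling₂ k m x)} (∑-≈ (λ m → ĉ m (- x)) x k))
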